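{- Let $\mathcal{C}$ be a hereditary graph class and $c\in\mathbb{R}_{\ge1}$. Let $\mathcal{A}$ be an algorithm that, given a graph $G$ and an integer $k$, runs in time $f(k)\cdot|V(G)|^{\mathcal{O}(1)}$ for some non-decreasing function $f$ and returns a minimum-size $\mathcal{C}$-modulator of $G$ whenever $G$ has a $\mathcal{C}$-modulator of size at most $k$. Let $\mathcal{B}$ be a polynomial-time algorithm for $c$-Essential Detection for $\mathcal{C}$-Deletion. Then there is an algorithm that, given a graph $G$, outputs a minimum-size $\mathcal{C}$-modulator of $G$ in time $f(\ell)\cdot|V(G)|^{\mathcal{O}(1)}$, where $\ell=\mathrm{opt}_\mathcal{C}(G)-|\mathcal{E}_c(G)|$.
   Context: A $\mathcal{C}$-modulator of $G$ is $S\subseteq V(G)$ with $G-S\in\mathcal{C}$; $\mathrm{opt}_\mathcal{C}(G)$ is the minimum size of one; $\mathcal{C}$-Deletion asks for a minimum one. A vertex $v$ is $c$-essential if every $\mathcal{C}$-modulator of size at most $c\cdot\mathrm{opt}_\mathcal{C}(G)$ contains $v$; $\mathcal{E}_c(G)$ is the set of $c$-essential vertices. $c$-Essential Detection for $\mathcal{C}$-Deletion: given $(G,k)$, output $S\subseteq V(G)$ such that (G1) if $\mathrm{opt}_\mathcal{C}(G)\le k$ then some minimum $\mathcal{C}$-modulator contains $S$, and (G2) if $\mathrm{opt}_\mathcal{C}(G)=k$ then $S$ contains all $c$-essential vertices. -}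

module Defs where

open import Data.Bool using (Bool; true; false)
open import Data.Fin using (Fin)
open import Data.Fin.Subset using (Subset; _∈_; _⊆_; ∣_∣)
open import Data.Fin.Subset.Properties using (_∈?_)
open import Data.Integer using (+_)
open import Data.List using (List; []; _∷_; allFin; filter; length; lookup; tabulate)
open import Data.Nat using (ℕ; zero; suc; _+_; _*_; _∸_; _^_; _≤_)
open import Data.Product using (Σ; ∃; ∃₂; _×_; _,_)
open import Data.Rational as ℚ using (ℚ; 1ℚ)
open import Data.Sum using (_⊎_)
open import Data.Vec using (toList)
open import Function using (_∘_)
open import Function.Bundles using (_⇔_)
open import Function.Definitions using (Injective)
open import Relation.Binary.PropositionalEquality using (_≡_)
open import Relation.Nullary using (¬_; ¬?)

-- Dedekind reals: a real x is given by the rationals q < x and the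
-- rationals q > x.

record ℝ : Set₁ where
  field
    lower upper     : ℚ → Set
    lower-inhabited : ∃ lower
    upper-inhabited : ∃ upper
    lower-open      : ∀ q → lower q ⇔ (∃ λ r → q ℚ.< r × lower r)
    upper-open      : ∀ q → upper q ⇔ (∃ λ r → r ℚ.< q × upper r)
    disjoint        : ∀ q → ¬ (lower q × upper q)
    located         : ∀ q r → q ℚ.< r → lower q ⊎ upper r

fromℕ : ℕ → ℚ
fromℕ n = + n ℚ./ 1

-- A number is at most x iff it is at most every rational above x; since
-- n ≥ 0, the same criterion applied to x · n needs only the multiples
-- q · n with q above x.

1≤_ : ℝ → Set
1≤ x = ∀ q → ℝ.upper x q → 1ℚ ℚ.≤ q

_≤_·_ : ℕ → ℝ → ℕ → Set
m ≤ x · n = ∀ q → ℝ.upper x q → fromℕ m ℚ.≤ q ℚ.* fromℕ n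

-- Finite simple undirected graphs, with vertex set Fin order.

record Graph : Set where
  field
    order      : ℕ
    adj        : Fin order → Fin order → Bool
    adj-sym    : ∀ u v → adj u v ≡ adj v u
    adj-irrefl : ∀ v → adj v v ≡ false

open Graph public

infix 4 _⊑_

-- H is isomorphic to an induced subgraph of G.

_⊑_ : Graph → Graph → Set
H ⊑ G = Σ (Fin (order H) → Fin (order G)) λ φ →
  Injective _≡_ _≡_ φ × (∀ u v → adj H u v ≡ adj G (φ u) (φ v))

GraphClass : Set₁
GraphClass = Graph → Set

-- This includes invariance under isomorphism.

Hereditary : GraphClass → Set
Hereditary C = ∀ {G H} → H ⊑ G → C G → C H

-- The vertices outside S are renumbered in increasing order.

_∖_ : (G : Graph) → Subset (order G) → Graph
G ∖ S = record
  { order      = length rest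
  ; adj        = λ u v → adj G (lookup rest u) (lookup rest v)
  ; adj-sym    = λ u v → adj-sym G (lookup rest u) (lookup rest v)
  ; adj-irrefl = λ v → adj-irrefl G (lookup rest v)
  }
  where
  rest : List (Fin (order G))
  rest = filter (λ v → ¬? (v ∈? S)) (allFin (order G))

module _ (C : GraphClass) where

  IsModulator : (G : Graph) → Subset (order G) → Set
  IsModulator G S = C (G ∖ S)

  IsMinimumModulator : (G : Graph) → Subset (order G) → Set
  IsMinimumModulator G S =
    IsModulator G S × (∀ T → IsModulator G T → ∣ S ∣ ≤ ∣ T ∣)

  -- opt is a relation, since C need not be decidable.

  Opt_≔_ : Graph → ℕ → Set
  Opt G ≔ k = ∃ λ S → IsMinimumModulator G S × ∣ S ∣ ≡ k

  Essential : ℝ → (G : Graph) → Fin (order G) → Set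
  Essential c G v =
    ∀ k → Opt G ≔ k → ∀ S → IsModulator G S → ∣ S ∣ ≤ c · k → v ∈ S

  IsEssentialSet : ℝ → (G : Graph) → Subset (order G) → Set
  IsEssentialSet c G E = ∀ v → v ∈ E ⇔ Essential c G v

  IsDetectionOutput : ℝ → (G : Graph) → ℕ → Subset (order G) → Set
  IsDetectionOutput c G k S =
      (∀ o → Opt G ≔ o → o ≤ k → ∃ λ T → IsMinimumModulator G T × S ⊆ T)
    × (Opt G ≔ k → ∀ v → Essential c G v → v ∈ S)

-- The model of computation is a WHILE language on binary trees with
-- Jones's unit-cost measure (trees are shared pointer structures, so that
-- pairing costs one step); it is Turing complete and agrees with Turing
-- machines up to polynomial overhead.  Programs have a single input and a
-- single output instead of variables: a store of several variables is a
-- nested pair.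

data Tree : Set where
  leaf : Tree
  node : Tree → Tree → Tree

infixr 5 _⨾_

data Program : Set where
  skip nil hd tl      : Program
  ⟨_,_⟩               : Program → Program → Program
  _⨾_                 : Program → Program → Program
  if_then_else_       : Program → Program → Program → Program
  while_loop_         : Program → Program → Program

infix 4 _∶_⇓_[_]

-- p ∶ x ⇓ y [ t ]: on input x, program p halts with output y after t steps.
-- The tests of if and while read leaf as false and every node as true.

data _∶_⇓_[_] : Program → Tree → Tree → ℕ → Set where
  skip    : ∀ {x} → skip ∶ x ⇓ x [ 1 ]
  nil     : ∀ {x} → nil ∶ x ⇓ leaf [ 1 ]
  hd-leaf : hd ∶ leaf ⇓ leaf [ 1 ]
  hd-node : ∀ {x y} → hd ∶ node x y ⇓ x [ 1 ]
  tl-leaf : tl ∶ leaf ⇓ leaf [ 1 ]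
  tl-node : ∀ {x y} → tl ∶ node x y ⇓ y [ 1 ]
  pair    : ∀ {p q x y z s t} →
            p ∶ x ⇓ y [ s ] → q ∶ x ⇓ z [ t ] →
            ⟨ p , q ⟩ ∶ x ⇓ node y z [ suc (s + t) ]
  seq     : ∀ {p q x y z s t} →
            p ∶ x ⇓ y [ s ] → q ∶ y ⇓ z [ t ] →
            p ⨾ q ∶ x ⇓ z [ suc (s + t) ]
  if-true : ∀ {b p q x y y′ z s t} →
            b ∶ x ⇓ node y y′ [ s ] → p ∶ x ⇓ z [ t ] →
            if b then p else q ∶ x ⇓ z [ suc (s + t) ]
  if-false : ∀ {b p q x z s t} →
            b ∶ x ⇓ leaf [ s ] → q ∶ x ⇓ z [ t ] →
            if b then p else q ∶ x ⇓ z [ suc (s + t) ]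
  while-stop : ∀ {b p x s} →
            b ∶ x ⇓ leaf [ s ] →
            while b loop p ∶ x ⇓ x [ suc s ]
  while-step : ∀ {b p x y y′ z w s t u} →
            b ∶ x ⇓ node y y′ [ s ] → p ∶ x ⇓ z [ t ] →
            while b loop p ∶ z ⇓ w [ u ] →
            while b loop p ∶ x ⇓ w [ suc (s + t + u) ]

encodeList : {A : Set} → (A → Tree) → List A → Tree
encodeList enc []       = leaf
encodeList enc (x ∷ xs) = node (enc x) (encodeList enc xs)

encodeBool : Bool → Tree
encodeBool false = leaf
encodeBool true  = node leaf leaf

-- Parameters are written in unary.

encodeℕ : ℕ → Tree
encodeℕ zero    = leaf
encodeℕ (suc n) = node leaf (encodeℕ n)

-- A graph is written as its adjacency matrix, a vertex set as its
-- characteristic vector.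

encodeGraph : Graph → Tree
encodeGraph G =
  encodeList (encodeList encodeBool) (tabulate λ u → tabulate λ v → adj G u v)

encodeSubset : ∀ {n} → Subset n → Tree
encodeSubset = encodeList encodeBool ∘ toList

encodeInstance : Graph → ℕ → Tree
encodeInstance G k = node (encodeGraph G) (encodeℕ k)

-- A bound n^O(1) is rendered as (2 + n) ^ d for some constant d; the shift
-- lets it absorb constant factors also for n ≤ 1.

module _ (C : GraphClass) where

  -- If there is no modulator of size at most k, the output is arbitrary,
  -- but the time bound still applies.

  SolvesDeletionParameterized : Program → (ℕ → ℕ) → Set
  SolvesDeletionParameterized A f =
    ∃ λ d → ∀ G k → ∃₂ λ r t →
        A ∶ encodeInstance G k ⇓ r [ t ]
      × t ≤ f k * (2 + order G) ^ d
      × ((∃ λ S → IsModulator C G S × ∣ S ∣ ≤ k) →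
         ∃ λ S → IsMinimumModulator C G S × r ≡ encodeSubset S)

  -- |V(G)| + k is the instance size up to a polynomial, k being in unary.

  SolvesDetectionPolyTime : Program → ℝ → Set
  SolvesDetectionPolyTime B c =
    ∃ λ d → ∀ G k → ∃₂ λ S t →
        B ∶ encodeInstance G k ⇓ encodeSubset S [ t ]
      × t ≤ (2 + (order G + k)) ^ d
      × IsDetectionOutput C c G k S

  -- Every graph has a modulator unless C is empty, in which case opt is
  -- undefined.  The time bound is quantified over E because the set of
  -- essential vertices is not computed; it is unique when it is given.

  SolvesDeletionBeyondEssential : Program → ℝ → (ℕ → ℕ) → Set
  SolvesDeletionBeyondEssential P c f =
    ∃ λ d → ∀ G → ∃ (IsModulator C G) → ∃₂ λ S t →
        P ∶ encodeGraph G ⇓ encodeSubset S [ t ]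
      × IsMinimumModulator C G S
      × (∀ o E → Opt_≔_ C G o → IsEssentialSet C c G E →
         t ≤ f (o ∸ ∣ E ∣) * (2 + order G) ^ d)

{-# OPTIONS --safe #-}

-- A's answer is arbitrary when no modulator of size at most k exists, so it
-- has to be verified.  Membership in C takes calls with parameter 1 only: if
-- H minus a vertex is in C, then opt(H) ≤ 1, so A(H, 1) is a minimum modulator
-- and H ∈ C iff it is empty.  The factor f(1) is a constant.
--
-- For S = B(G, k) and X = S ∪ A(G ∖ S, b), accept X if ∣X∣ ≤ k,
-- ∣X∣ ≤ ∣S∣ + b and G ∖ X ∈ C.  Then opt ≤ k, so by (G1) some minimum
-- modulator T contains S; as ∣T∣ ≤ ∣X∣ ≤ ∣S∣ + b, the set T ∖ S fits into the
-- budget b, so A is optimal on G ∖ S and X is minimum.  Conversely, (G1) gives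
-- acceptance for k = opt and b = opt ∸ ∣S∣, and this b is at most ℓ by (G2).
-- Hence trying b = 0, 1, … in turn, each with all k ≤ ∣V(G)∣, succeeds before
-- b exceeds ℓ.

module Submission where

open import Defs
open import Data.Bool as Bool using (Bool; true; false; not)
open import Data.Fin using (Fin; zero; suc)
open import Data.Fin.Properties as Fin using ()
open import Data.Fin.Subset using (Subset; _∈_; _∉_; _⊆_; ∣_∣; ⊥; ⁅_⁆)
open import Data.Fin.Subset.Properties
  using (_∈?_; drop-∷-⊆; drop-there; p⊆q⇒∣p∣≤∣q∣; x∈⁅x⁆; x∈⁅y⁆⇒x≡y; ∣p∣≤n; ∣⁅x⁆∣≡1; ∣⊥∣≡0)
open import Data.List using (List; []; _∷_; _ʳ++_; allFin; drop; filter; foldl; length;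
                             lookup; map; reverse; tabulate)
open import Data.List.Membership.Propositional.Properties using (∈-allFin; ∈-filter⁺; ∈-filter⁻; ∈-lookup)
open import Data.List.Properties
  using (∷-injectiveˡ; ∷-injectiveʳ; filter-accept; filter-reject; length-filter; length-map; length-reverse;
         length-tabulate; map-id; map-tabulate; reverse-involutive; tabulate-cong; tabulate-lookup)
open import Data.List.Relation.Unary.All as All using ()
open import Data.List.Relation.Unary.AllPairs using (_∷_)
open import Data.List.Relation.Unary.Any using (index)
open import Data.List.Relation.Unary.Any.Properties using (lookup-index)
open import Data.List.Relation.Unary.Unique.Propositional using (Unique)
open import Data.List.Relation.Unary.Unique.Propositional.Properties using (allFin⁺; filter⁺)
open import Data.Maybe using (Maybe; just; nothing; Is-just; _<∣>_)
open import Data.Maybe.Relation.Unary.Any using (just)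
open import Data.Nat
  using (ℕ; zero; suc; pred; _+_; _*_; _∸_; _^_; _≤_; _<_; _≤?_; _≟_; _≤ᵇ_; _≡ᵇ_; z≤n; s≤s)
open import Data.Nat.Properties hiding (_≤?_; _≟_)
open import Data.Product using (Σ; ∃; _×_; _,_; proj₁; proj₂)
open import Data.Sum using (inj₁; inj₂)
open import Data.Unit using (tt)
open import Data.Vec as Vec using (Vec; []; _∷_; here; there; toList)
open import Data.Vec.Properties using ([]=⇒lookup; length-toList; lookup⇒[]=; lookup∘tabulate)
open import Function using (_∘_; flip; id)
open import Function.Bundles using (Equivalence)
open import Function.Definitions using (Injective)
open import Relation.Binary.Core using (_Preserves_⟶_)
open import Relation.Binary.PropositionalEquality
open import Relation.Nullary using (Dec; yes; no; ¬?; contradiction; does; _×-dec_)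

-- Asymptotic running times

-- Neither `f` nor the parameter is known to the program, so a call to `A` with too large a budget
-- could not be interrupted in time. The cost must be controlled by the order of the search alone:
-- `b` grows in the outer loop, no call to `A` on a candidate follows a success, and so every such
-- call has a budget of at most `excess` and is paid for by monotonicity of `f`. The inner loop over
-- `k` is harmless, since `k` enters only the cost of `B`, which is polynomial. That `b` stays below
-- `excess` is a fact about the execution, not about the input of a single round. Hence programs are
-- bounded on families of inputs whose indices may carry proofs, and loop states contain the
-- invariants on which the cost of a round depends. As `C` need not be decidable, every decision is
-- read off from answers of `A`, and any tree that `A` may return has to be readable as a vertex
-- set.

record Scale : Set where
  constructor scale
  field
    size       : ℕ
    -- Stands for the value of `f`, which no fixed power of the size need bound. Being positive, it
    -- leaves room for constant costs.
    factor     : ℕ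
    factor-pos : 1 ≤ factor

open Scale

infix 4 _≤_^^_

-- A record and not a synonym, so that unification recovers scale and exponent from the type instead
-- of meeting an unfolded product and power.
record _≤_^^_ (t : ℕ) (s : Scale) (d : ℕ) : Set where
  constructor affordable
  field
    bound : t ≤ factor s * (2 + size s) ^ d

open _≤_^^_

1≤^^0 : ∀ s → 1 ≤ s ^^ 0
1≤^^0 s = affordable (*-mono-≤ (factor-pos s) ≤-refl)

^^-monoˡ : ∀ {s d t u} → u ≤ t → t ≤ s ^^ d → u ≤ s ^^ d
^^-monoˡ u≤t (affordable t≤) = affordable (≤-trans u≤t t≤)

^^-monoʳ : ∀ {s d e t} → d ≤ e → t ≤ s ^^ d → t ≤ s ^^ e
^^-monoʳ {s} d≤e (affordable t≤) = affordable (≤-trans t≤ (*-monoʳ-≤ (factor s) (^-monoʳ-≤ (2 + size s) d≤e)))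

^^-* : ∀ {s d k t} → k ≤ 2 + size s → t ≤ s ^^ d → k * t ≤ s ^^ suc d
^^-* {s} {d} {k} {t} k≤ (affordable t≤) = affordable (begin
  k * t               ≤⟨ *-mono-≤ k≤ t≤ ⟩
  N * (F * N ^ d)     ≡⟨ *-assoc N F _ ⟨
  N * F * N ^ d       ≡⟨ cong (_* N ^ d) (*-comm N F) ⟩
  F * N * N ^ d       ≡⟨ *-assoc F N _ ⟩
  F * N ^ suc d       ∎)
  where
  open ≤-Reasoning
  N = 2 + size s
  F = factor s

-- One extra power pays for the doubling because the base is at least 2. Exponents are added
-- generously: only their independence of the input matters.
^^-+ : ∀ {s d e t u} → t ≤ s ^^ d → u ≤ s ^^ e → t + u ≤ s ^^ suc (d + e)
^^-+ {s} {d} {e} {t} {u} t≤ u≤ = ^^-monoˡ t+u≤ (^^-* {k = 2} (m≤m+n 2 (size s)) (affordable ≤-refl))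
  where
  open ≤-Reasoning
  m = factor s * (2 + size s) ^ (d + e)
  t+u≤ : t + u ≤ 2 * m
  t+u≤ = begin
    t + u   ≤⟨ +-mono-≤ (bound (^^-monoʳ (m≤m+n d e) t≤)) (bound (^^-monoʳ (m≤n+m e d) u≤)) ⟩
    m + m   ≡⟨ cong (m +_) (+-identityʳ m) ⟨
    2 * m   ∎

const-^^ : ∀ s k → k ≤ s ^^ k
const-^^ s zero    = affordable z≤n
const-^^ s (suc k) = ^^-+ (1≤^^0 s) (const-^^ s k)

-- The exponent is the same for all inputs of the family.
record Runs {I : Set} (s : I → Scale) (p : Program) (x y : I → Tree) : Set where
  constructor runs
  field
    exponent : ℕ
    run      : ∀ i → ∃ λ t → p ∶ x i ⇓ y i [ t ] × t ≤ s i ^^ exponent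

hdT tlT : Tree → Tree
hdT leaf       = leaf
hdT (node x _) = x
tlT leaf       = leaf
tlT (node _ y) = y

isNode : Tree → Bool
isNode leaf       = false
isNode (node _ _) = true

variable
  I : Set
  s : I → Scale
  p q b : Program
  x y z : I → Tree

runs-skip : Runs s skip x x
runs-skip {s = s} = runs 0 λ i → 1 , skip , 1≤^^0 (s i)

runs-nil : Runs s nil x (λ _ → leaf)
runs-nil {s = s} = runs 0 λ i → 1 , nil , 1≤^^0 (s i)

runs-hd : Runs s hd x (hdT ∘ x)
runs-hd {s = s} {x = x} = runs 0 λ i → 1 , step (x i) , 1≤^^0 (s i)
  where
  step : ∀ w → hd ∶ w ⇓ hdT w [ 1 ]
  step leaf       = hd-leaf
  step (node _ _) = hd-node

runs-tl : Runs s tl x (tlT ∘ x)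
runs-tl {s = s} {x = x} = runs 0 λ i → 1 , step (x i) , 1≤^^0 (s i)
  where
  step : ∀ w → tl ∶ w ⇓ tlT w [ 1 ]
  step leaf       = tl-leaf
  step (node _ _) = tl-node

runs-pair : Runs s p x y → Runs s q x z → Runs s ⟨ p , q ⟩ x (λ i → node (y i) (z i))
runs-pair {s = s} (runs d f) (runs e g) = runs (suc (suc (d + e))) λ i →
  let (_ , p⇓ , t≤) = f i ; (_ , q⇓ , u≤) = g i
  in _ , pair p⇓ q⇓ , ^^-+ (1≤^^0 (s i)) (^^-+ t≤ u≤)

infixr 5 _⨾ᴿ_

_⨾ᴿ_ : Runs s p x y → Runs s q y z → Runs s (p ⨾ q) x z
_⨾ᴿ_ {s = s} (runs d f) (runs e g) = runs (suc (suc (d + e))) λ i →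
  let (_ , p⇓ , t≤) = f i ; (_ , q⇓ , u≤) = g i
  in _ , seq p⇓ q⇓ , ^^-+ (1≤^^0 (s i)) (^^-+ t≤ u≤)

-- Reindexing of a family. Scale, input and output are compared pointwise and as one triple, so a
-- single match on `refl` moves all three.
runs-via : {J : Set} {s′ : J → Scale} {x′ y′ : J → Tree} → Runs s′ p x′ y′ →
           (∀ i → ∃ λ j → (s′ j , x′ j , y′ j) ≡ (s i , x i , y i)) → Runs s p x y
runs-via {p = p} (runs d f) g = runs d λ i → move (proj₂ (g i)) (f (proj₁ (g i)))
  where
  move : ∀ {a b} → a ≡ b → let (s , x , y) = a ; (s′ , x′ , y′) = b in
         (∃ λ t → p ∶ x ⇓ y [ t ] × t ≤ s ^^ d) →
         ∃ λ t → p ∶ x′ ⇓ y′ [ t ] × t ≤ s′ ^^ d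
  move refl r = r

runs-≡ : Runs s p x y → (∀ i → y i ≡ z i) → Runs s p x z
runs-≡ r eq = runs-via r λ i → i , cong (λ w → _ , _ , w) (eq i)

runs-rescale : {s s′ : I → Scale} (c e : ℕ) →
               (∀ i → 2 + size (s i) ≤ (2 + size (s′ i)) ^ c) →
               (∀ i → factor (s i) ≤ s′ i ^^ e) →
               Runs s p x y → Runs s′ p x y
runs-rescale {s = s} {s′ = s′} c e size≤ factor≤ (runs d f) = runs (e + c * d) λ i →
  let (t , p⇓ , t≤) = f i
  in t , p⇓ , affordable (≤-trans (bound t≤) (rescaled i))
  where
  open ≤-Reasoning
  rescaled : ∀ i → factor (s i) * (2 + size (s i)) ^ d ≤ factor (s′ i) * (2 + size (s′ i)) ^ (e + c * d)
  rescaled i = begin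
    factor (s i) * (2 + size (s i)) ^ d ≤⟨ *-mono-≤ (bound (factor≤ i)) (^-monoˡ-≤ d (size≤ i)) ⟩
    F * N ^ e * (N ^ c) ^ d             ≡⟨ cong (F * N ^ e *_) (^-*-assoc N c d) ⟩
    F * N ^ e * N ^ (c * d)             ≡⟨ *-assoc F _ _ ⟩
    F * (N ^ e * N ^ (c * d))           ≡⟨ cong (F *_) (^-distribˡ-+-* N e (c * d)) ⟨
    F * N ^ (e + c * d)                 ∎
    where
    N = 2 + size (s′ i)
    F = factor (s′ i)

-- Each branch is required only on the inputs that reach it, with the outcome of the test in the
-- index. The search needs this: its branches are correct and affordable on different states.
runs-if : {c : I → Tree} → Runs s b x c →
          Runs {Σ I λ i → isNode (c i) ≡ true}  (s ∘ proj₁) p (x ∘ proj₁) (y ∘ proj₁) →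
          Runs {Σ I λ i → isNode (c i) ≡ false} (s ∘ proj₁) q (x ∘ proj₁) (y ∘ proj₁) →
          Runs s (if b then p else q) x y
runs-if {s = s} {b = b} {x = x} {p = p} {y = y} {q = q} {c = c} (runs d f) (runs e g) (runs e′ h) =
  runs D λ i → choose i (f i) (g ∘ (i ,_)) (h ∘ (i ,_))
  where
  D = suc (suc (d + (e + e′)))
  total : ∀ i {t u k} → t ≤ s i ^^ d → k ≤ e + e′ → u ≤ s i ^^ k → suc (t + u) ≤ s i ^^ D
  total i t≤ k≤ u≤ = ^^-+ (1≤^^0 (s i))
    (^^-+ t≤ (^^-monoʳ k≤ u≤))
  choose : ∀ i → (∃ λ t → b ∶ x i ⇓ c i [ t ] × t ≤ s i ^^ d) →
    (isNode (c i) ≡ true → ∃ λ t → p ∶ x i ⇓ y i [ t ] × t ≤ s i ^^ e) →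
    (isNode (c i) ≡ false → ∃ λ t → q ∶ x i ⇓ y i [ t ] × t ≤ s i ^^ e′) →
    ∃ λ t → if b then p else q ∶ x i ⇓ y i [ t ] × t ≤ s i ^^ D
  choose i (t , b⇓ , t≤) then′ else′ with c i
  ... | leaf     = let (u , q⇓ , u≤) = else′ refl
                   in _ , if-false b⇓ q⇓ , total i t≤ (m≤n+m e′ e) u≤
  ... | node _ _ = let (u , p⇓ , u≤) = then′ refl
                   in _ , if-true b⇓ p⇓ , total i t≤ (m≤m+n e e′) u≤

runs-if-else : {c : I → Tree} → Runs s b x c → Runs s p x y → Runs s q x z →
               Runs s (if b then p else q) x (λ i → Bool.if isNode (c i) then y i else z i)
runs-if-else {y = y} {z = z} rb rp rq = runs-if rb
  (runs-via rp λ (i , eq) → i , cong (λ a → _ , _ , (Bool.if a then y i else z i)) (sym eq))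
  (runs-via rq λ (i , eq) → i , cong (λ a → _ , _ , (Bool.if a then y i else z i)) (sym eq))

-- The step sees the whole unread list next to the accumulator, so it reads the current entry by
-- `hd ⨾ hd` and the accumulator by `tl`.
foldP : Program → Program
foldP step = (while hd loop ⟨ hd ⨾ tl , step ⟩) ⨾ tl

-- The step must be bounded on all of `B i`, reached or not. An invariant on which its cost depends
-- therefore has to be built into the type of the accumulator.
runs-foldl : {A B : I → Set} (ea : ∀ i → A i → Tree) (eb : ∀ i → B i → Tree) (g : ∀ i → B i → A i → B i)
             (l : ∀ i → List (A i)) (b : ∀ i → B i) → (∀ i → length (l i) ≤ 2 + size (s i)) →
             Runs {Σ I λ i → B i × A i × Tree} (s ∘ proj₁) p
               (λ (i , b , a , w) → node (node (ea i a) w) (eb i b)) (λ (i , b , a , _) → eb i (g i b a)) →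
             Runs s (foldP p) (λ i → node (encodeList (ea i) (l i)) (eb i (b i)))
                              (λ i → eb i (foldl (g i) (b i) (l i)))
runs-foldl {I = I} {s = s} {p = p} {A = A} {B = B} ea eb g l b l≤ (runs d f) =
  runs _ λ i →
    let (t , ⇓ , t≤) = iterate i (l i) (b i)
    in _ , seq ⇓ tl-node ,
       ^^-+ (const-^^ (s i) 1)
         (^^-+ (^^-monoˡ t≤ (^^-+ (const-^^ (s i) 2) (^^-* (l≤ i) (^^-+ {e = d} (const-^^ (s i) 6) (affordable ≤-refl)))))
               (const-^^ (s i) 1))
  where
  open ≤-Reasoning
  T : I → ℕ
  T i = factor (s i) * (2 + size (s i)) ^ d
  iterate : ∀ i as b → ∃ λ t →
    while hd loop ⟨ hd ⨾ tl , p ⟩ ∶ node (encodeList (ea i) as) (eb i b) ⇓ node leaf (eb i (foldl (g i) b as)) [ t ]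
    × t ≤ 2 + length as * (6 + T i)
  iterate i []       b = _ , while-stop hd-node , ≤-refl
  iterate i (a ∷ as) b =
    let (t , p⇓ , t≤) = f (i , b , a , encodeList (ea i) as)
        (u , w⇓ , u≤) = iterate i as (g i b a)
    in _ , while-step hd-node (pair (seq hd-node tl-node) p⇓) w⇓ , (begin
      -- One step for the loop, one for its test, one for the pairing and three for `hd ⨾ tl`; the
      -- failing last round costs 2.
      6 + t + u                                    ≤⟨ +-mono-≤ (+-monoʳ-≤ 6 (bound t≤)) u≤ ⟩
      6 + T i + (2 + length as * (6 + T i))        ≡⟨ +-assoc (6 + T i) 2 _ ⟨
      6 + T i + 2 + length as * (6 + T i)          ≡⟨ cong (_+ length as * (6 + T i)) (+-comm (6 + T i) 2) ⟩
      2 + (6 + T i + length as * (6 + T i))        ∎)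

-- Programs on lists

encodeList-map : {A B : Set} (enc : B → Tree) (f : A → B) (l : List A) →
                 encodeList enc (map f l) ≡ encodeList (enc ∘ f) l
encodeList-map enc f []      = refl
encodeList-map enc f (a ∷ l) = cong (node (enc (f a))) (encodeList-map enc f l)

bit : Bool → ℕ
bit false = 0
bit true  = 1

weight : List Bool → ℕ
weight []       = 0
weight (b ∷ bs) = bit b + weight bs

-- The mask marks what is deleted, as in `G ∖ S`. An exhausted mask keeps the rest, so that the
-- empty mask turns `filterMapP` into a plain map, as in `dropVertexP`.
filterBy : {A : Set} → List Bool → List A → List A
filterBy bs           []      = []
filterBy []           l       = l
filterBy (true  ∷ bs) (a ∷ l) = filterBy bs l
filterBy (false ∷ bs) (a ∷ l) = a ∷ filterBy bs l

filterBy-[] : {A : Set} (l : List A) → filterBy [] l ≡ l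
filterBy-[] []      = refl
filterBy-[] (a ∷ l) = refl

map-filterBy : {A B : Set} (f : A → B) (bs : List Bool) (l : List A) →
               map f (filterBy bs l) ≡ filterBy bs (map f l)
map-filterBy f bs           []      = refl
map-filterBy f []           (a ∷ l) = refl
map-filterBy f (true  ∷ bs) (a ∷ l) = map-filterBy f bs l
map-filterBy f (false ∷ bs) (a ∷ l) = cong (f a ∷_) (map-filterBy f bs l)

-- Reads a set of the vertices outside S, renumbered in increasing order, as a
-- set of all vertices and adds S to it.
extend : ∀ {n} → Subset n → Tree → Subset n
extend []          r = []
extend (true  ∷ S) r = true ∷ extend S r
extend (false ∷ S) r = isNode (hdT r) ∷ extend S (tlT r)

-- The size of `r` read as a set of `n` vertices. The length is given separately because `r` may be
-- any tree returned by `A`.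
nodes : ℕ → Tree → ℕ
nodes zero    r = 0
nodes (suc n) r = bit (isNode (hdT r)) + nodes n (tlT r)

isNode-encodeBool : ∀ b → isNode (encodeBool b) ≡ b
isNode-encodeBool true  = refl
isNode-encodeBool false = refl

reverseP : Program
reverseP = ⟨ skip , nil ⟩ ⨾ foldP ⟨ hd ⨾ hd , tl ⟩

runs-reverse : {I : Set} {s : I → Scale} {A : I → Set} (ea : ∀ i → A i → Tree) (l : ∀ i → List (A i)) →
               (∀ i → length (l i) ≤ 2 + size (s i)) →
               Runs s reverseP (λ i → encodeList (ea i) (l i)) (λ i → encodeList (ea i) (reverse (l i)))
runs-reverse ea l l≤ = runs-pair runs-skip runs-nil ⨾ᴿ
  runs-foldl ea (λ i → encodeList (ea i)) (λ i → flip _∷_) l (λ i → []) l≤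
    (runs-pair (runs-hd ⨾ᴿ runs-hd) runs-tl)

lengthP : Program
lengthP = ⟨ skip , nil ⟩ ⨾ foldP ⟨ nil , tl ⟩

runs-length : {I : Set} {s : I → Scale} {A : I → Set} (ea : ∀ i → A i → Tree) (l : ∀ i → List (A i)) →
              (∀ i → length (l i) ≤ 2 + size (s i)) →
              Runs s lengthP (λ i → encodeList (ea i) (l i)) (λ i → encodeℕ (length (l i)))
runs-length ea l l≤ = runs-≡
  (runs-pair runs-skip runs-nil ⨾ᴿ
    runs-foldl ea (λ i → encodeℕ) (λ i m a → suc m) l (λ i → 0) l≤ (runs-pair runs-nil runs-tl))
  λ i → cong encodeℕ (trans (counted (l i) 0) (+-identityʳ _))
  where
  counted : {X : Set} (l : List X) (m : ℕ) → foldl (λ m a → suc m) m l ≡ length l + m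
  counted []      m = refl
  counted (a ∷ l) m = trans (counted l (suc m)) (+-suc (length l) m)

onBitsP : Program → Program
onBitsP p = foldP (if hd ⨾ hd then tl ⨾ p else tl)

runs-onBits : {I : Set} {s : I → Scale} {p : Program} (h : ℕ → ℕ) →
              (∀ {J} {s : J → Scale} {m : J → ℕ} → Runs s p (encodeℕ ∘ m) (encodeℕ ∘ h ∘ m)) →
              (bs : I → List Bool) (m : I → ℕ) → (∀ i → length (bs i) ≤ 2 + size (s i)) →
              Runs s (onBitsP p) (λ i → node (encodeList encodeBool (bs i)) (encodeℕ (m i)))
                (λ i → encodeℕ (foldl (λ m b → Bool.if b then h m else m) (m i) (bs i)))
runs-onBits h rp bs m bs≤ =
  runs-foldl (λ i → encodeBool) (λ i → encodeℕ) (λ i m b → Bool.if b then h m else m) bs m bs≤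
    (runs-≡ (runs-if-else (runs-hd ⨾ᴿ runs-hd) (runs-tl ⨾ᴿ rp) runs-tl)
      λ { (i , m , true , w) → refl ; (i , m , false , w) → refl })

-- Sizes are compared through truncated subtraction, which leaves a node exactly when the minuend is
-- the larger number.
addWeightP subWeightP : Program
addWeightP = onBitsP ⟨ nil , skip ⟩
subWeightP = onBitsP tl

runs-addWeight : {I : Set} {s : I → Scale} (bs : I → List Bool) (m : I → ℕ) →
                 (∀ i → length (bs i) ≤ 2 + size (s i)) →
                 Runs s addWeightP (λ i → node (encodeList encodeBool (bs i)) (encodeℕ (m i)))
                   (λ i → encodeℕ (weight (bs i) + m i))
runs-addWeight bs m bs≤ = runs-≡ (runs-onBits suc (runs-pair runs-nil runs-skip) bs m bs≤)
  λ i → cong encodeℕ (added (bs i) (m i))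
  where
  added : ∀ bs m → foldl (λ m b → Bool.if b then suc m else m) m bs ≡ weight bs + m
  added []           m = refl
  added (true  ∷ bs) m = trans (added bs (suc m)) (+-suc (weight bs) m)
  added (false ∷ bs) m = added bs m

runs-subWeight : {I : Set} {s : I → Scale} (bs : I → List Bool) (m : I → ℕ) →
                 (∀ i → length (bs i) ≤ 2 + size (s i)) →
                 Runs s subWeightP (λ i → node (encodeList encodeBool (bs i)) (encodeℕ (m i)))
                   (λ i → encodeℕ (m i ∸ weight (bs i)))
runs-subWeight bs m bs≤ = runs-≡ (runs-onBits pred (λ {_} {_} {m} → runs-≡ runs-tl (tl-pred ∘ m)) bs m bs≤)
  λ i → cong encodeℕ (subtracted (bs i) (m i))
  where
  tl-pred : ∀ m → tlT (encodeℕ m) ≡ encodeℕ (pred m)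
  tl-pred zero    = refl
  tl-pred (suc m) = refl
  subtracted : ∀ bs m → foldl (λ m b → Bool.if b then pred m else m) m bs ≡ m ∸ weight bs
  subtracted []           m       = refl
  subtracted (true  ∷ bs) zero    = trans (subtracted bs 0) (0∸n≡0 (weight bs))
  subtracted (true  ∷ bs) (suc m) = subtracted bs m
  subtracted (false ∷ bs) m       = subtracted bs m

-- The list is only a clock: its length tells how many entries of the neighbouring tree to read.
addNodesP : Program
addNodesP = foldP ⟨ tl ⨾ hd ⨾ tl , if tl ⨾ hd ⨾ hd then ⟨ nil , tl ⨾ tl ⟩ else (tl ⨾ tl) ⟩ ⨾ tl

runs-addNodes : {I : Set} {s : I → Scale} {A : I → Set} (ea : ∀ i → A i → Tree)
                (l : ∀ i → List (A i)) (r : I → Tree) (m : I → ℕ) →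
                (∀ i → length (l i) ≤ 2 + size (s i)) →
                Runs s addNodesP (λ i → node (encodeList (ea i) (l i)) (node (r i) (encodeℕ (m i))))
                  (λ i → encodeℕ (nodes (length (l i)) (r i) + m i))
runs-addNodes {A = A} ea l r m l≤ = runs-≡
  (runs-foldl ea (λ i (r , m) → node r (encodeℕ m)) (λ i → g) l (λ i → r i , m i) l≤
    (runs-≡ (runs-pair (runs-tl ⨾ᴿ runs-hd ⨾ᴿ runs-tl)
              (runs-if-else (runs-tl ⨾ᴿ runs-hd ⨾ᴿ runs-hd) (runs-pair runs-nil (runs-tl ⨾ᴿ runs-tl)) (runs-tl ⨾ᴿ runs-tl)))
      λ (i , (r , m) , a , w) → cong (node (tlT r)) (bumped r m)) ⨾ᴿ runs-tl)
  λ i → cong encodeℕ (counted (l i) (r i) (m i))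
  where
  g : {X : Set} → Tree × ℕ → X → Tree × ℕ
  g (r , m) _ = tlT r , bit (isNode (hdT r)) + m
  bumped : ∀ r m → (Bool.if isNode (hdT r) then node leaf (encodeℕ m) else encodeℕ m) ≡
                   encodeℕ (bit (isNode (hdT r)) + m)
  bumped r m with isNode (hdT r)
  ... | true  = refl
  ... | false = refl
  counted : {X : Set} (l : List X) (r : Tree) (m : ℕ) → proj₂ (foldl g (r , m) l) ≡ nodes (length l) r + m
  counted []      r m = refl
  counted (a ∷ l) r m = begin
    proj₂ (foldl g (tlT r , c + m) l)        ≡⟨ counted l (tlT r) (c + m) ⟩
    nodes (length l) (tlT r) + (c + m)       ≡⟨ +-assoc (nodes (length l) (tlT r)) c m ⟨
    nodes (length l) (tlT r) + c + m         ≡⟨ cong (_+ m) (+-comm (nodes (length l) (tlT r)) c) ⟩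
    c + nodes (length l) (tlT r) + m         ∎
    where
    open ≡-Reasoning
    c = bit (isNode (hdT r))

-- The full mask travels with the accumulator and reaches `p` with each kept entry. So `p` can
-- itself filter by the same mask, which deletes columns along with rows.
filterMapP : Program → Program
filterMapP p = ⟨ hd , ⟨ tl , ⟨ nil , tl ⟩ ⟩ ⟩ ⨾ foldP step ⨾ tl ⨾ hd ⨾ reverseP
  where
  step = ⟨ tl ⨾ hd ⨾ tl
         , ⟨ if tl ⨾ hd ⨾ hd then (tl ⨾ tl ⨾ hd) else ⟨ ⟨ hd ⨾ hd , tl ⨾ tl ⨾ tl ⟩ ⨾ p , tl ⨾ tl ⨾ hd ⟩
           , tl ⨾ tl ⨾ tl ⟩ ⟩

runs-filterMap : {I : Set} {s : I → Scale} {p : Program} {A B : I → Set}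
                 (ea : ∀ i → A i → Tree) (eb : ∀ i → B i → Tree)
                 (h : ∀ i → A i → B i) (bs : I → List Bool) (l : ∀ i → List (A i)) →
                 (∀ i → length (l i) ≤ 2 + size (s i)) →
                 Runs {Σ I A} (s ∘ proj₁) p (λ (i , a) → node (ea i a) (encodeList encodeBool (bs i)))
                   (λ (i , a) → eb i (h i a)) →
                 Runs s (filterMapP p) (λ i → node (encodeList (ea i) (l i)) (encodeList encodeBool (bs i)))
                   (λ i → encodeList (eb i) (map (h i) (filterBy (bs i) (l i))))
runs-filterMap {A = A} {B} ea eb h bs l l≤ rp =
  runs-pair runs-hd (runs-pair runs-tl (runs-pair runs-nil runs-tl))
  ⨾ᴿ runs-foldl ea
       (λ i (cs , out) → node (encodeList encodeBool cs) (node (encodeList (eb i) out) (encodeList encodeBool (bs i))))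
       g l (λ i → bs i , []) l≤
       (runs-≡ (runs-pair (runs-tl ⨾ᴿ runs-hd ⨾ᴿ runs-tl)
                 (runs-pair (runs-if-else (runs-tl ⨾ᴿ runs-hd ⨾ᴿ runs-hd) (runs-tl ⨾ᴿ runs-tl ⨾ᴿ runs-hd)
                              (runs-pair (runs-pair (runs-hd ⨾ᴿ runs-hd) (runs-tl ⨾ᴿ runs-tl ⨾ᴿ runs-tl)
                                          ⨾ᴿ runs-via rp λ (i , _ , a , _) → (i , a) , refl)
                                (runs-tl ⨾ᴿ runs-tl ⨾ᴿ runs-hd)))
                   (runs-tl ⨾ᴿ runs-tl ⨾ᴿ runs-tl)))
         λ { (i , ([] , out) , a , w) → refl
           ; (i , (true  ∷ cs , out) , a , w) → refl
           ; (i , (false ∷ cs , out) , a , w) → refl })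
  ⨾ᴿ runs-tl ⨾ᴿ runs-hd
  ⨾ᴿ runs-≡ (runs-reverse eb (λ i → proj₂ (foldl (g i) (bs i , []) (l i)))
               λ i → ≤-trans (short i (l i) (bs i) []) (≤-trans (≤-reflexive (+-identityʳ _)) (l≤ i)))
       λ i → cong (encodeList (eb i)) (trans (cong reverse (collected i (l i) (bs i) [])) (reverse-involutive _))
  where
  g : ∀ i → List Bool × List (B i) → A i → List Bool × List (B i)
  g i ([]         , out) a = [] , h i a ∷ out
  g i (true  ∷ cs , out) a = cs , out
  g i (false ∷ cs , out) a = cs , h i a ∷ out
  collected : ∀ i l cs out → proj₂ (foldl (g i) (cs , out) l) ≡ map (h i) (filterBy cs l) ʳ++ out
  collected i []      []           out = refl
  collected i []      (c ∷ cs)     out = refl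
  collected i (a ∷ l) []           out = trans (collected i l [] (h i a ∷ out))
    (cong (λ k → map (h i) k ʳ++ (h i a ∷ out)) (filterBy-[] l))
  collected i (a ∷ l) (true  ∷ cs) out = collected i l cs out
  collected i (a ∷ l) (false ∷ cs) out = collected i l cs (h i a ∷ out)
  short : ∀ i l cs out → length (proj₂ (foldl (g i) (cs , out) l)) ≤ length l + length out
  short i []      cs           out = ≤-refl
  short i (a ∷ l) []           out = ≤-trans (short i l [] (h i a ∷ out)) (≤-reflexive (+-suc (length l) (length out)))
  short i (a ∷ l) (true  ∷ cs) out = m≤n⇒m≤1+n (short i l cs out)
  short i (a ∷ l) (false ∷ cs) out = ≤-trans (short i l cs (h i a ∷ out)) (≤-reflexive (+-suc (length l) (length out)))

-- Entries of the second tree are replaced by proper truth values, so the output encodes a vertex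
-- set whatever `A` has returned.
extendP : Program
extendP = ⟨ hd , ⟨ tl , nil ⟩ ⟩ ⨾ foldP step ⨾ tl ⨾ reverseP
  where
  step = if hd ⨾ hd then ⟨ tl ⨾ hd , ⟨ ⟨ nil , nil ⟩ , tl ⨾ tl ⟩ ⟩
                    else ⟨ tl ⨾ hd ⨾ tl , ⟨ if tl ⨾ hd ⨾ hd then ⟨ nil , nil ⟩ else nil , tl ⨾ tl ⟩ ⟩

runs-extend : {I : Set} {s : I → Scale} {k : I → ℕ} (S : ∀ i → Subset (k i)) (r : I → Tree) →
              (∀ i → k i ≤ 2 + size (s i)) →
              Runs s extendP (λ i → node (encodeSubset (S i)) (r i)) (λ i → encodeSubset (extend (S i) (r i)))
runs-extend {s = s} {k} S r k≤ =
  runs-pair runs-hd (runs-pair runs-tl runs-nil)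
  ⨾ᴿ runs-foldl (λ i → encodeBool) (λ i (r , out) → node r (encodeList encodeBool out)) (λ i → g)
       (toList ∘ S) (λ i → r i , []) S≤
       (runs-≡ (runs-if-else (runs-hd ⨾ᴿ runs-hd)
                 (runs-pair (runs-tl ⨾ᴿ runs-hd) (runs-pair (runs-pair runs-nil runs-nil) (runs-tl ⨾ᴿ runs-tl)))
                 (runs-pair (runs-tl ⨾ᴿ runs-hd ⨾ᴿ runs-tl)
                   (runs-pair (runs-if-else (runs-tl ⨾ᴿ runs-hd ⨾ᴿ runs-hd) (runs-pair runs-nil runs-nil) runs-nil)
                     (runs-tl ⨾ᴿ runs-tl))))
         λ { (i , (r , out) , true  , w) → refl
           ; (i , (r , out) , false , w) →
               cong (λ c → node (tlT r) (node c (encodeList encodeBool out))) (if-bool (isNode (hdT r))) })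
  ⨾ᴿ runs-tl
  ⨾ᴿ runs-≡ (runs-reverse (λ i → encodeBool) (λ i → proj₂ (foldl g (r i , []) (toList (S i))))
               λ i → ≤-trans (≤-reflexive (out-length i)) (k≤ i))
       λ i → cong (encodeList encodeBool) (trans (cong reverse (collected (S i) (r i) [])) (reverse-involutive _))
  where
  g : Tree × List Bool → Bool → Tree × List Bool
  g (r , out) true  = r , true ∷ out
  g (r , out) false = tlT r , isNode (hdT r) ∷ out
  if-bool : ∀ b → (Bool.if b then node leaf leaf else leaf) ≡ encodeBool b
  if-bool true  = refl
  if-bool false = refl
  collected : ∀ {n} (S : Subset n) r out → proj₂ (foldl g (r , out) (toList S)) ≡ toList (extend S r) ʳ++ out
  collected []          r out = refl
  collected (true  ∷ S) r out = collected S r (true ∷ out)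
  collected (false ∷ S) r out = collected S (tlT r) (isNode (hdT r) ∷ out)
  S≤ : ∀ i → length (toList (S i)) ≤ 2 + size (s i)
  S≤ i = ≤-trans (≤-reflexive (length-toList (S i))) (k≤ i)
  out-length : ∀ i → length (proj₂ (foldl g (r i , []) (toList (S i)))) ≡ k i
  out-length i = begin
    length (proj₂ (foldl g (r i , []) (toList (S i)))) ≡⟨ cong length (collected (S i) (r i) []) ⟩
    length (reverse (toList (extend (S i) (r i))))     ≡⟨ length-reverse (toList (extend (S i) (r i))) ⟩
    length (toList (extend (S i) (r i)))               ≡⟨ length-toList (extend (S i) (r i)) ⟩
    k i                                                ∎
    where open ≡-Reasoning

-- Modulators of induced subgraphs

lookup-injective : {A : Set} {l : List A} → Unique l → Injective _≡_ _≡_ (lookup l)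
lookup-injective (_ ∷ _)  {zero}  {zero}  eq = refl
lookup-injective {l = _ ∷ l} (a∉l ∷ _) {zero}  {suc j} eq = contradiction eq (All.lookup a∉l (∈-lookup j))
lookup-injective {l = _ ∷ l} (a∉l ∷ _) {suc i} {zero}  eq = contradiction (sym eq) (All.lookup a∉l (∈-lookup i))
lookup-injective (_ ∷ u)  {suc i} {suc j} eq = cong suc (lookup-injective u eq)

tabulate-injective : {A : Set} {n : ℕ} {f g : Fin n → A} → tabulate f ≡ tabulate g → ∀ i → f i ≡ g i
tabulate-injective {n = suc n} eq zero    = ∷-injectiveˡ eq
tabulate-injective {n = suc n} eq (suc i) = tabulate-injective (∷-injectiveʳ eq) i

toList≡tabulate : {A : Set} {n : ℕ} (v : Vec A n) → toList v ≡ tabulate (Vec.lookup v)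
toList≡tabulate []      = refl
toList≡tabulate (a ∷ v) = cong (a ∷_) (toList≡tabulate v)

∣∣≡weight : ∀ {n} (S : Subset n) → ∣ S ∣ ≡ weight (toList S)
∣∣≡weight []          = refl
∣∣≡weight (true  ∷ S) = cong suc (∣∣≡weight S)
∣∣≡weight (false ∷ S) = ∣∣≡weight S

-- `filterBy (toList S) (toList S)` occurs only for its length, the number of vertices outside `S`,
-- in a form that reduces by recursion on `S`.
weight-extend : ∀ {n} (S : Subset n) cs → length cs ≡ length (filterBy (toList S) (toList S)) →
                ∣ extend S (encodeList encodeBool cs) ∣ ≡ ∣ S ∣ + weight cs
weight-extend []          []           eq = refl
weight-extend (true  ∷ S) cs           eq = cong suc (weight-extend S cs eq)
weight-extend (false ∷ S) (false ∷ cs) eq = weight-extend S cs (suc-injective eq)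
weight-extend (false ∷ S) (true  ∷ cs) eq =
  trans (cong suc (weight-extend S cs (suc-injective eq))) (sym (+-suc ∣ S ∣ (weight cs)))

filterBy-extend : ∀ {n} (S : Subset n) cs → length cs ≡ length (filterBy (toList S) (toList S)) →
                  filterBy (toList S) (toList (extend S (encodeList encodeBool cs))) ≡ cs
filterBy-extend []          []           eq = refl
filterBy-extend (true  ∷ S) cs           eq = filterBy-extend S cs eq
filterBy-extend (false ∷ S) (c ∷ cs)     eq = cong₂ _∷_ (isNode-encodeBool c) (filterBy-extend S cs (suc-injective eq))

⊆-extend : ∀ {n} (S : Subset n) r → S ⊆ extend S r
⊆-extend (true  ∷ S) r here        = here
⊆-extend (true  ∷ S) r (there v∈S) = there (⊆-extend S r v∈S)
⊆-extend (false ∷ S) r (there v∈S) = there (⊆-extend S (tlT r) v∈S)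

weight-filterBy : ∀ {n} (S T : Subset n) → S ⊆ T → ∣ T ∣ ≡ ∣ S ∣ + weight (filterBy (toList S) (toList T))
weight-filterBy []          []          S⊆T = refl
weight-filterBy (true  ∷ S) (true  ∷ T) S⊆T = cong suc (weight-filterBy S T (drop-∷-⊆ S⊆T))
weight-filterBy (true  ∷ S) (false ∷ T) S⊆T = contradiction (S⊆T here) λ ()
weight-filterBy (false ∷ S) (false ∷ T) S⊆T = weight-filterBy S T (drop-∷-⊆ S⊆T)
weight-filterBy (false ∷ S) (true  ∷ T) S⊆T = trans (cong suc (weight-filterBy S T (drop-∷-⊆ S⊆T))) (sym (+-suc ∣ S ∣ _))

nodes-encodeList : ∀ bs → nodes (length bs) (encodeList encodeBool bs) ≡ weight bs
nodes-encodeList []       = refl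
nodes-encodeList (b ∷ bs) = cong₂ _+_ (cong bit (isNode-encodeBool b)) (nodes-encodeList bs)

remaining : ∀ {n} → Subset n → List (Fin n)
remaining S = filter (λ v → ¬? (v ∈? S)) (allFin _)

filterBy-allFin : ∀ {n} (S : Subset n) → filterBy (toList S) (allFin n) ≡ remaining S
filterBy-allFin S = go S id S (λ i → id) (λ i → id)
  where
  -- The recursion consumes the mask while the filter keeps testing membership in the whole set. `f`
  -- locates the remaining positions, and the two implications say that `T` is `S` seen through `f`.
  go : ∀ {m n} (T : Subset m) (f : Fin m → Fin n) (S : Subset n) →
       (∀ i → f i ∈ S → i ∈ T) → (∀ i → i ∈ T → f i ∈ S) →
       filterBy (toList T) (tabulate f) ≡ filter (λ v → ¬? (v ∈? S)) (tabulate f)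
  go []          f S S⇒T T⇒S = refl
  go (true  ∷ T) f S S⇒T T⇒S = trans
    (go T (f ∘ suc) S (λ i → drop-there ∘ S⇒T (suc i)) (λ i → T⇒S (suc i) ∘ there))
    (sym (filter-reject (λ v → ¬? (v ∈? S)) (λ f0∉S → f0∉S (T⇒S zero here))))
  go (false ∷ T) f S S⇒T T⇒S = trans
    (cong (f zero ∷_) (go T (f ∘ suc) S (λ i → drop-there ∘ S⇒T (suc i)) (λ i → T⇒S (suc i) ∘ there)))
    (sym (filter-accept (λ v → ¬? (v ∈? S)) (λ f0∈S → contradiction (S⇒T zero f0∈S) λ ())))

map-lookup-remaining : ∀ {n} (S T : Subset n) → map (Vec.lookup T) (remaining S) ≡ filterBy (toList S) (toList T)
map-lookup-remaining S T = begin
  map (Vec.lookup T) (remaining S)                   ≡⟨ cong (map (Vec.lookup T)) (filterBy-allFin S) ⟨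
  map (Vec.lookup T) (filterBy (toList S) (allFin _)) ≡⟨ map-filterBy (Vec.lookup T) (toList S) (allFin _) ⟩
  filterBy (toList S) (map (Vec.lookup T) (allFin _)) ≡⟨ cong (filterBy (toList S)) (map-tabulate id (Vec.lookup T)) ⟩
  filterBy (toList S) (tabulate (Vec.lookup T))      ≡⟨ cong (filterBy (toList S)) (toList≡tabulate T) ⟨
  filterBy (toList S) (toList T)                     ∎
  where open ≡-Reasoning

lookup-remaining : ∀ {n} (S T : Subset n) (R : Subset (length (remaining S))) →
                   filterBy (toList S) (toList T) ≡ toList R →
                   ∀ j → Vec.lookup T (lookup (remaining S) j) ≡ Vec.lookup R j
lookup-remaining S T R eq = tabulate-injective (begin
  tabulate (Vec.lookup T ∘ lookup (remaining S))      ≡⟨ map-tabulate (lookup (remaining S)) (Vec.lookup T) ⟨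
  map (Vec.lookup T) (tabulate (lookup (remaining S))) ≡⟨ cong (map (Vec.lookup T)) (tabulate-lookup (remaining S)) ⟩
  map (Vec.lookup T) (remaining S)                    ≡⟨ map-lookup-remaining S T ⟩
  filterBy (toList S) (toList T)                      ≡⟨ eq ⟩
  toList R                                            ≡⟨ toList≡tabulate R ⟩
  tabulate (Vec.lookup R)                             ∎)
  where open ≡-Reasoning

length-toList-remaining : ∀ {n} (S : Subset n) (R : Subset (length (remaining S))) →
                          length (toList R) ≡ length (filterBy (toList S) (toList S))
length-toList-remaining S R = begin
  length (toList R)                         ≡⟨ length-toList R ⟩
  length (remaining S)                      ≡⟨ length-map (Vec.lookup S) (remaining S) ⟨
  length (map (Vec.lookup S) (remaining S)) ≡⟨ cong length (map-lookup-remaining S S) ⟩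
  length (filterBy (toList S) (toList S))   ∎
  where open ≡-Reasoning

restrict : ∀ {n} (S T : Subset n) → Subset (length (remaining S))
restrict S T = Vec.tabulate (Vec.lookup T ∘ lookup (remaining S))

toList-restrict : ∀ {n} (S T : Subset n) → filterBy (toList S) (toList T) ≡ toList (restrict S T)
toList-restrict S T = begin
  filterBy (toList S) (toList T)                   ≡⟨ map-lookup-remaining S T ⟨
  map (Vec.lookup T) (remaining S)                 ≡⟨ cong (map (Vec.lookup T)) (tabulate-lookup (remaining S)) ⟨
  map (Vec.lookup T) (tabulate (lookup (remaining S))) ≡⟨ map-tabulate (lookup (remaining S)) (Vec.lookup T) ⟩
  tabulate (Vec.lookup T ∘ lookup (remaining S))   ≡⟨ tabulate-cong (lookup∘tabulate (Vec.lookup T ∘ lookup (remaining S))) ⟨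
  tabulate (Vec.lookup (restrict S T))             ≡⟨ toList≡tabulate (restrict S T) ⟨
  toList (restrict S T)                            ∎
  where open ≡-Reasoning

∣restrict∣ : ∀ {n} (S T : Subset n) → S ⊆ T → ∣ T ∣ ≡ ∣ S ∣ + ∣ restrict S T ∣
∣restrict∣ S T S⊆T = trans (weight-filterBy S T S⊆T)
  (cong (∣ S ∣ +_) (trans (cong weight (toList-restrict S T)) (sym (∣∣≡weight (restrict S T)))))

∣extend∣ : ∀ {n} (S : Subset n) (R : Subset (length (remaining S))) → ∣ extend S (encodeSubset R) ∣ ≡ ∣ S ∣ + ∣ R ∣
∣extend∣ S R = trans (weight-extend S (toList R) (length-toList-remaining S R)) (cong (∣ S ∣ +_) (sym (∣∣≡weight R)))

-- For `l = remaining S` this is `G ∖ S` by definition, so a membership test on vertex lists decides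
-- modulators without any transport.
induced : (G : Graph) → List (Fin (order G)) → Graph
induced G l = record
  { order      = length l
  ; adj        = λ u v → adj G (lookup l u) (lookup l v)
  ; adj-sym    = λ u v → adj-sym G (lookup l u) (lookup l v)
  ; adj-irrefl = λ v → adj-irrefl G (lookup l v)
  }

⊑-refl : ∀ {G} → G ⊑ G
⊑-refl = id , id , λ _ _ → refl

⊑-trans : ∀ {G H K} → K ⊑ H → H ⊑ G → K ⊑ G
⊑-trans (φ , φ-inj , φ-adj) (ψ , ψ-inj , ψ-adj) =
  ψ ∘ φ , φ-inj ∘ ψ-inj , λ u v → trans (φ-adj u v) (ψ-adj (φ u) (φ v))

∖-⊑ : ∀ G S → G ∖ S ⊑ G
∖-⊑ G S = lookup (remaining S) , lookup-injective (filter⁺ _ (allFin⁺ _)) , λ _ _ → refl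

remaining-∉ : ∀ {n} (S : Subset n) j → lookup (remaining S) j ∉ S
remaining-∉ S j = proj₂ (∈-filter⁻ (λ v → ¬? (v ∈? S)) {xs = allFin _} (∈-lookup j))

position : ∀ {n} (S : Subset n) v → v ∉ S → ∃ λ j → v ≡ lookup (remaining S) j
position S v v∉S = index v∈ , lookup-index v∈
  where v∈ = ∈-filter⁺ (λ v → ¬? (v ∈? S)) (∈-allFin v) v∉S

-- The universal property of `G ∖ S`. With it, embedding into a vertex-deleted graph only asks which
-- vertices are avoided, and heredity never asks for more than an embedding.
⊑-∖ : ∀ {G H} S ((φ , _) : H ⊑ G) → (∀ u → φ u ∉ S) → H ⊑ G ∖ S
⊑-∖ {G} S (φ , φ-inj , φ-adj) φ∉S =
    (λ u → proj₁ (at u))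
  , (λ {u} {v} eq → φ-inj (trans (proj₂ (at u)) (trans (cong (lookup (remaining S)) eq) (sym (proj₂ (at v))))))
  , λ u v → trans (φ-adj u v) (cong₂ (adj G) (proj₂ (at u)) (proj₂ (at v)))
  where
  at : ∀ u → ∃ λ j → φ u ≡ lookup (remaining S) j
  at u = position S (φ u) (φ∉S u)

∖-restrict-⊑ : ∀ G S T → (G ∖ S) ∖ restrict S T ⊑ G ∖ T
∖-restrict-⊑ G S T = ⊑-∖ {G} {(G ∖ S) ∖ restrict S T} T
  (⊑-trans {G} {G ∖ S} {(G ∖ S) ∖ restrict S T} (∖-⊑ (G ∖ S) (restrict S T)) (∖-⊑ G S)) λ j v∈T →
  let u = lookup (remaining (restrict S T)) j in
  remaining-∉ (restrict S T) j (lookup⇒[]= u (restrict S T)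
    (trans (sym (lookup-remaining S T (restrict S T) (toList-restrict S T) u)) ([]=⇒lookup v∈T)))

-- Avoiding `S` and then `R` is checked by two uses of `⊑-∖`; `filterBy-extend` identifies the
-- entries of the extended set outside `S` with those of `R`.
∖-extend-⊑ : ∀ G S (R : Subset (order (G ∖ S))) → G ∖ extend S (encodeSubset R) ⊑ (G ∖ S) ∖ R
∖-extend-⊑ G S R = ⊑-∖ {G ∖ S} {G ∖ X} R
  (⊑-∖ {G} {G ∖ X} S (∖-⊑ G X) (λ u → remaining-∉ X u ∘ ⊆-extend S (encodeSubset R))) λ u w∈R →
  let v = lookup (remaining X) u
      (w , v≡) = position S v (remaining-∉ X u ∘ ⊆-extend S (encodeSubset R))
  in remaining-∉ X u (lookup⇒[]= v X (begin
    Vec.lookup X v                        ≡⟨ cong (Vec.lookup X) v≡ ⟩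
    Vec.lookup X (lookup (remaining S) w)
      ≡⟨ lookup-remaining S X R (filterBy-extend S (toList R) (length-toList-remaining S R)) w ⟩
    Vec.lookup R w                        ≡⟨ []=⇒lookup w∈R ⟩
    true                                  ∎))
  where
  open ≡-Reasoning
  X = extend S (encodeSubset R)

induced-[]-⊑ : ∀ G H → induced G [] ⊑ H
induced-[]-⊑ G H = (λ ()) , (λ { {()} }) , λ ()

induced-∷-⊒ : ∀ G v l → induced G l ⊑ induced G (v ∷ l)
induced-∷-⊒ G v l = suc , Fin.suc-injective , λ _ _ → refl

-- Makes the front vertex a modulator of size 1 as soon as the tail induces a graph in `C`.
induced-∷-∖-⊑ : ∀ G v l → induced G (v ∷ l) ∖ ⁅ zero ⁆ ⊑ induced G l
induced-∷-∖-⊑ G v l = φ , φ-inj , λ i j → cong₂ (adj K) (suc-φ i) (suc-φ j)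
  where
  K = induced G (v ∷ l)
  below : (w : Fin (suc (length l))) → w ∉ ⁅ zero ⁆ → ∃ λ u → w ≡ suc u
  below zero    w∉ = contradiction (x∈⁅x⁆ zero) w∉
  below (suc u) w∉ = u , refl
  φ : Fin (order (K ∖ ⁅ zero ⁆)) → Fin (length l)
  φ i = proj₁ (below _ (remaining-∉ ⁅ zero ⁆ i))
  suc-φ : ∀ i → lookup (remaining ⁅ zero ⁆) i ≡ suc (φ i)
  suc-φ i = proj₂ (below _ (remaining-∉ ⁅ zero ⁆ i))
  φ-inj : Injective _≡_ _≡_ φ
  φ-inj {i} {j} eq = proj₁ (proj₂ (∖-⊑ K ⁅ zero ⁆)) (trans (suc-φ i) (trans (cong suc eq) (sym (suc-φ j))))

-- Presents a graph and its induced subgraphs by vertex lists over one adjacency function, so that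
-- deleting vertices becomes an operation on lists.
encodeMatrix : {A : Set} → (A → A → Bool) → List A → Tree
encodeMatrix a l = encodeList (λ u → encodeList (λ v → encodeBool (a u v)) l) l

encodeList-tabulate : {A B : Set} {n : ℕ} (enc : B → Tree) (h : A → B) (f : Fin n → A) →
                      encodeList enc (tabulate (h ∘ f)) ≡ encodeList (enc ∘ h) (tabulate f)
encodeList-tabulate enc h f = trans (cong (encodeList enc) (sym (map-tabulate f h))) (encodeList-map enc h (tabulate f))

encodeMatrix-tabulate : {A : Set} {n : ℕ} (a : A → A → Bool) (f : Fin n → A) →
  encodeList (encodeList encodeBool) (tabulate λ i → tabulate λ j → a (f i) (f j)) ≡ encodeMatrix a (tabulate f)
encodeMatrix-tabulate a f = trans (encodeList-tabulate (encodeList encodeBool) (λ u → tabulate (a u ∘ f)) f)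
  (encodeList-cong (λ u → encodeList-tabulate encodeBool (a u) f) (tabulate f))
  where
  encodeList-cong : {B : Set} {g h : B → Tree} → (∀ b → g b ≡ h b) → ∀ l → encodeList g l ≡ encodeList h l
  encodeList-cong eq []      = refl
  encodeList-cong eq (b ∷ l) = cong₂ node (eq b) (encodeList-cong eq l)

encodeGraph≡ : ∀ G → encodeGraph G ≡ encodeMatrix (adj G) (allFin (order G))
encodeGraph≡ G = encodeMatrix-tabulate (adj G) id

encodeGraph-induced : ∀ G l → encodeGraph (induced G l) ≡ encodeMatrix (adj G) l
encodeGraph-induced G l = trans (encodeMatrix-tabulate (adj G) (lookup l)) (cong (encodeMatrix (adj G)) (tabulate-lookup l))

row : (G : Graph) → Fin (order G) → Tree
row G u = encodeList encodeBool (tabulate (adj G u))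

-- Used where a loop needs a counter of length `order G` and never looks inside the entries.
rows : Graph → List Tree
rows G = tabulate (row G)

encodeGraph-rows : ∀ G → encodeGraph G ≡ encodeList id (rows G)
encodeGraph-rows G = trans (encodeList-tabulate (encodeList encodeBool) (λ u → tabulate (adj G u)) id)
  (sym (encodeList-tabulate id (row G) id))

∣∣≡0⇒∉ : ∀ {n} (S : Subset n) → ∣ S ∣ ≡ 0 → ∀ v → v ∉ S
∣∣≡0⇒∉ S ∣S∣≡0 v v∈S = contradiction ∣S∣≡0 (m<n⇒n≢0 (≤-trans (≤-reflexive (sym (∣⁅x⁆∣≡1 v)))
  (p⊆q⇒∣p∣≤∣q∣ λ u∈ → subst (_∈ S) (sym (x∈⁅y⁆⇒x≡y v u∈)) v∈S)))

nodes-encodeSubset : ∀ {n} (S : Subset n) → nodes n (encodeSubset S) ≡ ∣ S ∣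
nodes-encodeSubset S = trans (cong (λ n → nodes n (encodeSubset S)) (sym (length-toList S)))
  (trans (nodes-encodeList (toList S)) (sym (∣∣≡weight S)))

-- Programs on graphs

length-allFin : ∀ n → length (allFin n) ≡ n
length-allFin n = length-tabulate id

length-remaining : ∀ {n} (S : Subset n) → length (remaining S) ≤ n
length-remaining {n} S = ≤-trans (length-filter _ (allFin n)) (≤-reflexive (length-allFin n))

subgraphP : Program
subgraphP = filterMapP (filterMapP hd)

runs-subgraph : {I : Set} {s : I → Scale} (G : I → Graph) (S : ∀ i → Subset (order (G i))) →
                (∀ i → order (G i) ≤ size (s i)) →
                Runs s subgraphP (λ i → node (encodeGraph (G i)) (encodeSubset (S i))) (λ i → encodeGraph (G i ∖ S i))
runs-subgraph {s = s} G S G≤ = runs-via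
  (runs-filterMap {A = Fin ∘ order ∘ G} {B = Fin ∘ order ∘ G} entire survived (λ i → id)
    (toList ∘ S) (allFin ∘ order ∘ G) allFin≤
    (runs-≡ (runs-filterMap {A = Fin ∘ order ∘ G ∘ proj₁} {B = Fin ∘ order ∘ G ∘ proj₁}
              (λ (i , u) v → encodeBool (adj (G i) u v)) (λ (i , u) v → encodeBool (adj (G i) u v)) (λ i → id)
              (toList ∘ S ∘ proj₁) (allFin ∘ order ∘ G ∘ proj₁) (allFin≤ ∘ proj₁) runs-hd)
      λ (i , u) → cong (encodeList λ v → encodeBool (adj (G i) u v)) (kept i)))
  λ i → i , cong₂ (λ M N → s i , node M (encodeSubset (S i)) , N) (sym (encodeGraph≡ (G i)))
    (trans (cong (encodeList (survived i)) (kept i)) (sym (encodeGraph-induced (G i) (remaining (S i)))))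
  where
  entire survived : ∀ i → Fin (order (G i)) → Tree
  entire   i u = encodeList (λ v → encodeBool (adj (G i) u v)) (allFin (order (G i)))
  survived i u = encodeList (λ v → encodeBool (adj (G i) u v)) (remaining (S i))
  allFin≤ : ∀ i → length (allFin (order (G i))) ≤ 2 + size (s i)
  allFin≤ i = ≤-trans (≤-reflexive (length-allFin (order (G i)))) (m≤n⇒m≤o+n 2 (G≤ i))
  kept : ∀ i → map id (filterBy (toList (S i)) (allFin (order (G i)))) ≡ remaining (S i)
  kept i = trans (map-id _) (filterBy-allFin (S i))

-- The first `tl` removes the row of the front vertex and `hd ⨾ tl` its entry in every other row;
-- `hd` strips the empty mask that `filterMapP` passes along.
dropVertexP : Program
dropVertexP = tl ⨾ ⟨ skip , nil ⟩ ⨾ filterMapP (hd ⨾ tl)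

runs-dropVertex : {I : Set} {s : I → Scale} (G : I → Graph) (l : ∀ i → List (Fin (order (G i)))) →
                  (∀ i → length (l i) ≤ size (s i)) →
                  Runs s dropVertexP (λ i → encodeGraph (induced (G i) (l i)))
                    (λ i → encodeGraph (induced (G i) (drop 1 (l i))))
runs-dropVertex {s = s} G l l≤ = runs-via
  (runs-≡ runs-tl (λ i → tl-drop _ (l i)) ⨾ᴿ runs-pair runs-skip runs-nil ⨾ᴿ
    runs-filterMap {A = Fin ∘ order ∘ G} {B = Fin ∘ order ∘ G}
      (λ i u → encodeList (λ v → encodeBool (adj (G i) u v)) (l i))
      (λ i u → encodeList (λ v → encodeBool (adj (G i) u v)) (drop 1 (l i))) (λ i → id) (λ i → []) (λ i → drop 1 (l i))
      (λ i → ≤-trans (length-drop-1 (l i)) (m≤n⇒m≤o+n 2 (l≤ i)))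
      (runs-≡ (runs-hd ⨾ᴿ runs-tl) λ (i , u) → tl-drop _ (l i)))
  λ i → i , cong₂ (λ M N → s i , M , N) (sym (encodeGraph-induced (G i) (l i)))
    (trans (cong (encodeList _) (trans (map-id _) (filterBy-[] _))) (sym (encodeGraph-induced (G i) (drop 1 (l i)))))
  where
  tl-drop : {A : Set} (enc : A → Tree) (k : List A) → tlT (encodeList enc k) ≡ encodeList enc (drop 1 k)
  tl-drop enc []      = refl
  tl-drop enc (a ∷ k) = refl
  length-drop-1 : {A : Set} (k : List A) → length (drop 1 k) ≤ length k
  length-drop-1 []      = z≤n
  length-drop-1 (a ∷ k) = n≤1+n (length k)

drop-1≤ : {A : Set} (l : List A) {n : ℕ} → length l ≤ n → length (drop 1 l) ≤ n
drop-1≤ []      l≤ = l≤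
drop-1≤ (a ∷ l) l≤ = ≤-trans (n≤1+n (length l)) l≤

Result : GraphClass → Graph → Set
Result C G = ∃ (IsMinimumModulator C G)

encodeMaybe : {R : Set} → (R → Tree) → Maybe R → Tree
encodeMaybe enc nothing  = leaf
encodeMaybe enc (just r) = node (enc r) leaf

encodeResult : ∀ C G → Result C G → Tree
encodeResult C G (X , _) = encodeSubset X

-- Phrased with `_≤ᵇ_` because `does` of `_≤?_` reduces to it, which lets the program's tests be
-- matched with `accepted?`.
isNode-monus : ∀ m a → isNode (encodeℕ (suc m ∸ a)) ≡ (a ≤ᵇ m)
isNode-monus m       zero          = refl
isNode-monus zero    (suc zero)    = refl
isNode-monus zero    (suc (suc a)) = refl
isNode-monus (suc m) (suc zero)    = refl
isNode-monus (suc m) (suc (suc a)) = isNode-monus m (suc a)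

isNode-encodeℕ : ∀ m → isNode (encodeℕ m) ≡ not (m ≡ᵇ 0)
isNode-encodeℕ zero    = refl
isNode-encodeℕ (suc m) = refl

toMaybe : {P R : Set} → Dec P → (P → R) → Maybe R
toMaybe (yes p) h = just (h p)
toMaybe (no _)  h = nothing

toMaybe-just : {P R : Set} (P? : Dec P) (h : P → R) → P → Is-just (toMaybe P? h)
toMaybe-just (yes p) h q = just tt
toMaybe-just (no ¬p) h q = contradiction q ¬p

steps>0 : ∀ {p x y t} → p ∶ x ⇓ y [ t ] → 1 ≤ t
steps>0 skip             = s≤s z≤n
steps>0 nil              = s≤s z≤n
steps>0 hd-leaf          = s≤s z≤n
steps>0 hd-node          = s≤s z≤n
steps>0 tl-leaf          = s≤s z≤n
steps>0 tl-node          = s≤s z≤n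
steps>0 (pair _ _)       = s≤s z≤n
steps>0 (seq _ _)        = s≤s z≤n
steps>0 (if-true _ _)    = s≤s z≤n
steps>0 (if-false _ _)   = s≤s z≤n
steps>0 (while-stop _)   = s≤s z≤n
steps>0 (while-step _ _ _) = s≤s z≤n

-- Membership in `C` through calls to `A`

module Deletion {C : GraphClass} (hereditary : Hereditary C) {f : ℕ → ℕ}
                {A : Program} (solvesA : SolvesDeletionParameterized C A f) where

  output : Graph → ℕ → Tree
  output G k = proj₁ (proj₂ solvesA G k)

  output-minimum : ∀ G k S → IsModulator C G S → ∣ S ∣ ≤ k →
                   ∃ λ R → IsMinimumModulator C G R × output G k ≡ encodeSubset R
  output-minimum G k S mod S≤ = proj₂ (proj₂ (proj₂ (proj₂ (proj₂ solvesA G k)))) (S , mod , S≤)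

  -- Even on the null graph `A` takes a step, which the time bound would forbid if `f k` were 0.
  f-pos : ∀ k → 1 ≤ f k
  f-pos k with f k | proj₂ solvesA (induced edgeless []) k
    where
    edgeless : Graph
    edgeless = record { order = 0 ; adj = λ () ; adj-sym = λ () ; adj-irrefl = λ () }
  ... | zero  | _ , _ , A⇓ , t≤ , _ = ≤-trans (steps>0 A⇓) t≤
  ... | suc _ | _                   = s≤s z≤n

  -- The exponent `e` pays for `f (k i)`: it is `f 1` in the membership test, where that value is a
  -- constant, and 0 in the search, where the factor of the scale covers the cost.
  runs-A : {I : Set} {s : I → Scale} (G : I → Graph) (k : I → ℕ) (e : ℕ) → (∀ i → order (G i) ≤ size (s i)) →
           (∀ i → f (k i) ≤ s i ^^ e) →
           Runs s A (λ i → encodeInstance (G i) (k i)) (λ i → output (G i) (k i))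
  runs-A G k e G≤ f≤ = runs-rescale {s = λ i → scale (order (G i)) (f (k i)) (f-pos (k i))} 1 e
    (λ i → ≤-trans (+-monoʳ-≤ 2 (G≤ i)) (≤-reflexive (sym (*-identityʳ _)))) f≤
    (runs (proj₁ solvesA) λ i → let (_ , t , A⇓ , t≤ , _) = proj₂ solvesA (G i) (k i) in t , A⇓ , affordable t≤)

  module _ (G : Graph) where

    -- The one-vertex test, summed over all nonempty suffixes. If the null graph is in `C`, the
    -- shortest suffix outside `C` gets a valid, nonempty answer; answers for longer suffixes may be
    -- arbitrary, but the sum is positive already.
    violations : List (Fin (order G)) → ℕ
    violations []      = 0
    violations (v ∷ l) = nodes (suc (length l)) (output (induced G (v ∷ l)) 1) + violations l

    violations≡0⇒∈C : C (induced G []) → ∀ l → violations l ≡ 0 → C (induced G l)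
    violations≡0⇒∈C null []      eq = null
    violations≡0⇒∈C null (v ∷ l) eq =
      let K = induced G (v ∷ l)
          (S , (mod , _) , r≡) = output-minimum K 1 ⁅ zero ⁆
            (hereditary {induced G l} {K ∖ ⁅ zero ⁆} (induced-∷-∖-⊑ G v l)
              (violations≡0⇒∈C null l (m+n≡0⇒n≡0 (nodes (suc (length l)) (output K 1)) eq)))
            (≤-reflexive (∣⁅x⁆∣≡1 {suc (length l)} zero))
          ∣S∣≡0 = trans (sym (nodes-encodeSubset S))
            (trans (cong (nodes (suc (length l))) (sym r≡)) (m+n≡0⇒m≡0 _ eq))
      in hereditary {K ∖ S} {K} (⊑-∖ {K} {K} S (⊑-refl {K}) (∣∣≡0⇒∉ S ∣S∣≡0)) mod

    ∈C⇒violations≡0 : ∀ l → C (induced G l) → violations l ≡ 0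
    ∈C⇒violations≡0 []      _  = refl
    ∈C⇒violations≡0 (v ∷ l) K∈ =
      let K = induced G (v ∷ l)
          ⊥-mod = hereditary {K} {K ∖ ⊥} (∖-⊑ K ⊥) K∈
          (S , (_ , minimal) , r≡) = output-minimum K 1 ⊥ ⊥-mod (≤-trans (≤-reflexive (∣⊥∣≡0 (suc (length l)))) z≤n)
          ∣S∣≡0 = n≤0⇒n≡0 (≤-trans (minimal ⊥ ⊥-mod) (≤-reflexive (∣⊥∣≡0 (suc (length l)))))
      in cong₂ _+_ (trans (cong (nodes (suc (length l))) r≡) (trans (nodes-encodeSubset S) ∣S∣≡0))
           (∈C⇒violations≡0 l (hereditary {K} {induced G l} (induced-∷-⊒ G v l) K∈))

  testP : Program
  testP = ⟨ skip , ⟨ skip , nil ⟩ ⟩ ⨾ foldP step ⨾ tl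
    where
    -- `⟨ nil , nil ⟩` is the parameter 1 in unary.
    step = ⟨ tl ⨾ hd ⨾ dropVertexP , ⟨ tl ⨾ hd , ⟨ ⟨ tl ⨾ hd , ⟨ nil , nil ⟩ ⟩ ⨾ A , tl ⨾ tl ⟩ ⟩ ⨾ addNodesP ⟩

  runs-test : {I : Set} {s : I → Scale} (G : I → Graph) (l : ∀ i → List (Fin (order (G i)))) →
              (∀ i → length (l i) ≤ size (s i)) →
              Runs s testP (λ i → encodeGraph (induced (G i) (l i))) (λ i → encodeℕ (violations (G i) (l i)))
  runs-test {I} {s} G l l≤ =
    runs-≡ (runs-pair runs-skip (runs-pair runs-skip runs-nil))
      (λ i → cong (λ M → node M (node (current i (l i)) leaf)) (encodeGraph-induced (G i) (l i)))
    ⨾ᴿ runs-foldl (λ i u → encodeList (λ v → encodeBool (adj (G i) u v)) (l i))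
         (λ i ((k , _) , m) → node (current i k) (encodeℕ m))
         g l (λ i → (l i , l≤ i) , 0) (λ i → m≤n⇒m≤o+n 2 (l≤ i))
         (runs-pair (runs-tl ⨾ᴿ runs-hd ⨾ᴿ runs-dropVertex (G ∘ proj₁) list list≤)
           (runs-pair (runs-≡ (runs-tl ⨾ᴿ runs-hd) λ x → encodeGraph-induced (G (proj₁ x)) (list x))
             (runs-pair (runs-pair (runs-tl ⨾ᴿ runs-hd) (runs-pair runs-nil runs-nil)
                         ⨾ᴿ runs-A (λ x → induced (G (proj₁ x)) (list x)) (λ _ → 1) (f 1) list≤
                              (λ x → const-^^ (s (proj₁ x)) (f 1)))
               (runs-tl ⨾ᴿ runs-tl))
            ⨾ᴿ runs-addNodes (λ x u → encodeList (λ v → encodeBool (adj (G (proj₁ x)) u v)) (list x)) list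
                 (λ x → output (induced (G (proj₁ x)) (list x)) 1) (λ x → proj₂ (proj₁ (proj₂ x)))
                 (λ x → m≤n⇒m≤o+n 2 (list≤ x))))
    ⨾ᴿ runs-≡ runs-tl λ i → cong encodeℕ (trans (tested i (l i) (l≤ i) 0) (+-identityʳ _))
    where
    B : I → Set
    -- The length bound belongs to the accumulator because `A` is affordable only on graphs within
    -- the scale.
    B i = (∃ λ (k : List (Fin (order (G i)))) → length k ≤ size (s i)) × ℕ
    current : ∀ i → List (Fin (order (G i))) → Tree
    current i k = encodeGraph (induced (G i) k)
    g : ∀ i → B i → Fin (order (G i)) → B i
    g i ((k , k≤) , m) _ = (drop 1 k , drop-1≤ k k≤) , nodes (length k) (output (induced (G i) k) 1) + m
    list : (x : Σ I λ i → B i × Fin (order (G i)) × Tree) → List (Fin (order (G (proj₁ x))))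
    list (_ , ((k , _) , _) , _) = k
    list≤ : ∀ x → length (list x) ≤ size (s (proj₁ x))
    list≤ (_ , ((_ , k≤) , _) , _) = k≤
    tested : ∀ i k k≤ m → proj₂ (foldl (g i) ((k , k≤) , m) k) ≡ violations (G i) k + m
    tested i []      k≤ m = refl
    tested i (v ∷ k) k≤ m = begin
      proj₂ (foldl (g i) ((k , _) , c + m) k) ≡⟨ tested i k _ (c + m) ⟩
      violations (G i) k + (c + m)            ≡⟨ +-assoc (violations (G i) k) c m ⟨
      violations (G i) k + c + m              ≡⟨ cong (_+ m) (+-comm (violations (G i) k) c) ⟩
      c + violations (G i) k + m              ∎
      where
      open ≡-Reasoning
      c = nodes (suc (length k)) (output (induced (G i) (v ∷ k)) 1)

-- Search over k and b

encodeMaybe-toMaybe : {P R : Set} (enc : R → Tree) (P? : Dec P) (h : P → R) (w : Tree) →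
  (∀ p → enc (h p) ≡ w) →
  encodeMaybe enc (toMaybe P? h) ≡ (Bool.if does P? then node w leaf else leaf)
encodeMaybe-toMaybe enc (yes p) h w eq = cong (λ z → node z leaf) (eq p)
encodeMaybe-toMaybe enc (no _)  h w eq = refl

nested-if : ∀ {c′ d′ e′ t} c d e → c′ ≡ c → d′ ≡ d → e′ ≡ not e →
  (Bool.if c′ then Bool.if d′ then Bool.if e′ then leaf else t else leaf else leaf) ≡
  (Bool.if c Bool.∧ d Bool.∧ e then t else leaf)
nested-if false d     e     refl refl refl = refl
nested-if true  false e     refl refl refl = refl
nested-if true  true  false refl refl refl = refl
nested-if true  true  true  refl refl refl = refl

module Sweep {R : Set} (n : ℕ) (attempt : ℕ → Maybe R) where

  SweepState : Set
  SweepState = (∃ λ k → k ≤ n) × Maybe R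

  -- Counting down keeps `k ≤ n`, which bounds the cost of `B`, and needs only `tl`. A later success
  -- may replace an earlier one, since any accepted result will do.
  sweepStep : {X : Set} → SweepState → X → SweepState
  sweepStep ((k , k≤) , r) _ = (pred k , ≤-trans pred[n]≤n k≤) , (attempt k <∣> r)

  sweep : {X : Set} → List X → Maybe R
  sweep l = proj₂ (foldl sweepStep ((n , ≤-refl) , nothing) l)

  keeps : {X : Set} (l : List X) {k : ∃ λ k → k ≤ n} {r : Maybe R} →
          Is-just r → Is-just (proj₂ (foldl sweepStep (k , r) l))
  keeps []      r-just = r-just
  keeps (_ ∷ l) {k , _} {r} r-just = keeps l (kept (attempt k))
    where
    kept : ∀ m → Is-just (m <∣> r)
    kept (just _) = just tt
    kept nothing  = r-just

  -- Invariant: the counter has not passed `k`, and enough rounds are left for it to come down to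
  -- `k`.
  finds : {X : Set} (l : List X) (k j : ℕ) {j≤ : j ≤ n} {r : Maybe R} →
          Is-just (attempt k) → k ≤ j → j < k + length l →
          Is-just (proj₂ (foldl sweepStep ((j , j≤) , r) l))
  finds []      k j k-just k≤j j< = contradiction (≤-trans j< (≤-reflexive (+-identityʳ k))) (≤⇒≯ k≤j)
  finds (_ ∷ l) k j {r = r} k-just k≤j j< with m≤n⇒m<n∨m≡n k≤j
  ... | inj₂ refl = keeps l (new (attempt j) k-just)
    where
    new : ∀ m → Is-just m → Is-just (m <∣> r)
    new (just _) _ = just tt
  ... | inj₁ k<j  = finds l k (pred j) k-just (<⇒≤pred k<j) (later j k<j j<)
    where
    later : ∀ j → k < j → j < k + suc (length l) → pred j < k + length l
    later (suc j) _ j< = ≤-pred (≤-trans j< (≤-reflexive (+-suc k (length l))))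

  sweep-finds : {X : Set} (l : List X) (k : ℕ) → Is-just (attempt k) → k ≤ n → n < length l → Is-just (sweep l)
  sweep-finds l k k-just k≤n n< = finds l k n k-just k≤n (≤-trans n< (m≤n+m (length l) k))

module Search {R : Set} (attempt : ℕ → Maybe R) (goal : ℕ) (goal-just : Is-just (attempt goal)) where

  -- The bound in `searching` makes every attempt affordable. It survives a failure because `goal`
  -- succeeds, so a failing `b` lies strictly below it.
  data SearchState : Set where
    searching : ∀ b → b ≤ goal → SearchState
    found     : ℕ → R → SearchState

  advance : ∀ b (r : Maybe R) → (r ≡ nothing → b < goal) → SearchState
  -- The program increments `b` whether or not the attempt succeeds.
  advance b (just r) _  = found (suc b) r
  advance b nothing  b< = searching (suc b) (b< refl)

  not-yet : ∀ {b} → b ≤ goal → attempt b ≡ nothing → b < goal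
  not-yet b≤ eq = ≤∧≢⇒< b≤ λ { refl → contradiction (subst Is-just eq goal-just) λ () }

  searchStep : {X : Set} → SearchState → X → SearchState
  searchStep (searching b b≤) _ = advance b (attempt b) (not-yet b≤)
  searchStep (found b r)      _ = found b r

  settled : {X : Set} (l : List X) (d : ℕ) (r : R) → foldl searchStep (found d r) l ≡ found d r
  settled []      d r = refl
  settled (_ ∷ l) d r = settled l d r

  search-finds : {X : Set} (l : List X) (b : ℕ) (b≤ : b ≤ goal) → goal < b + length l →
                 ∃ λ d → ∃ λ r → foldl searchStep (searching b b≤) l ≡ found d r
  search-finds []      b b≤ goal< = contradiction (≤-trans goal< (≤-reflexive (+-identityʳ b))) (≤⇒≯ b≤)
  search-finds (_ ∷ l) b b≤ goal< = continue (attempt b) (not-yet b≤)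
    where
    continue : ∀ r b< → ∃ λ d → ∃ λ r′ → foldl searchStep (advance b r b<) l ≡ found d r′
    continue (just r) b< = suc b , r , settled l (suc b) r
    continue nothing  b< = search-finds l (suc b) _ (≤-trans goal< (≤-reflexive (+-suc b (length l))))

  search : {X : Set} (l : List X) → goal < length l → R
  search l goal< = proj₁ (proj₂ (search-finds l 0 z≤n goal<))

sweepP : Program → Program
sweepP p = ⟨ hd , ⟨ tl ⨾ hd , ⟨ nil , tl ⨾ tl ⟩ ⟩ ⟩ ⨾ foldP step ⨾ tl ⨾ hd
  where
  step = ⟨ tl ⨾ hd ⨾ tl
         , ⟨ ⟨ ⟨ tl ⨾ hd , tl ⨾ tl ⨾ tl ⟩ ⨾ p , tl ⨾ tl ⨾ hd ⟩ ⨾ if hd then hd else tl , tl ⨾ tl ⨾ tl ⟩ ⟩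

runs-sweep : {I : Set} {s : I → Scale} {p : Program} {R : I → Set} (enc : ∀ i → R i → Tree) (env : I → Tree)
             (n : I → ℕ) (attempt : ∀ i → ℕ → Maybe (R i)) (l : I → List Tree) →
             (∀ i → length (l i) ≤ 2 + size (s i)) →
             Runs {Σ I λ i → ∃ λ k → k ≤ n i} (s ∘ proj₁) p (λ (i , k , _) → node (encodeℕ k) (env i))
               (λ (i , k , _) → encodeMaybe (enc i) (attempt i k)) →
             Runs s (sweepP p) (λ i → node (encodeList id (l i)) (node (encodeℕ (n i)) (env i)))
               (λ i → encodeMaybe (enc i) (Sweep.sweep (n i) (attempt i) (l i)))
runs-sweep {I} {s} {R = R} enc env n attempt l l≤ rp =
  runs-pair runs-hd (runs-pair (runs-tl ⨾ᴿ runs-hd) (runs-pair runs-nil (runs-tl ⨾ᴿ runs-tl)))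
  ⨾ᴿ runs-foldl (λ _ → id) encodeState (λ i → Sweep.sweepStep (n i) (attempt i)) l
       (λ i → (n i , ≤-refl) , nothing) l≤
       (runs-≡
         (runs-pair (runs-tl ⨾ᴿ runs-hd ⨾ᴿ runs-tl)
           (runs-pair
             (runs-pair
               (runs-pair (runs-tl ⨾ᴿ runs-hd) (runs-tl ⨾ᴿ runs-tl ⨾ᴿ runs-tl)
                ⨾ᴿ runs-via rp λ (i , ((k , k≤) , _) , _) → (i , k , k≤) , refl)
               (runs-tl ⨾ᴿ runs-tl ⨾ᴿ runs-hd)
              ⨾ᴿ runs-if-else runs-hd runs-hd runs-tl)
             (runs-tl ⨾ᴿ runs-tl ⨾ᴿ runs-tl)))
         λ (i , ((k , _) , r) , _) → cong₂ (λ x y → node x (node y (env i))) (tl-pred k) (first (enc i) (attempt i k) r))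
  ⨾ᴿ runs-tl ⨾ᴿ runs-hd
  where
  encodeState : ∀ i → Sweep.SweepState (n i) (attempt i) → Tree
  encodeState i ((k , _) , r) = node (encodeℕ k) (node (encodeMaybe (enc i) r) (env i))
  tl-pred : ∀ k → tlT (encodeℕ k) ≡ encodeℕ (pred k)
  tl-pred zero    = refl
  tl-pred (suc k) = refl
  first : {R : Set} (enc : R → Tree) (r r′ : Maybe R) →
    (Bool.if isNode (encodeMaybe enc r) then encodeMaybe enc r else encodeMaybe enc r′) ≡ encodeMaybe enc (r <∣> r′)
  first enc (just _) r′ = refl
  first enc nothing  r′ = refl

searchP : Program → Program
searchP p = ⟨ hd , ⟨ nil , ⟨ nil , tl ⟩ ⟩ ⟩ ⨾ foldP step ⨾ hd ⨾ hd
  where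
  -- After a success the remaining rounds only copy the state: another attempt could have a budget
  -- above `goal` and exceed the time bound.
  step = if tl ⨾ hd then tl else ⟨ tl ⨾ tl ⨾ p , ⟨ ⟨ nil , tl ⨾ tl ⨾ hd ⟩ , tl ⨾ tl ⨾ tl ⟩ ⟩

runs-search : {I : Set} {s : I → Scale} {p : Program} {R : I → Set} (enc : ∀ i → R i → Tree) (env : I → Tree)
              (attempt : ∀ i → ℕ → Maybe (R i)) (goal : I → ℕ) (goal-just : ∀ i → Is-just (attempt i (goal i)))
              (l : I → List Tree) → (∀ i → length (l i) ≤ 2 + size (s i)) →
              (goal< : ∀ i → goal i < length (l i)) →
              Runs {Σ I λ i → ∃ λ b → b ≤ goal i} (s ∘ proj₁) p (λ (i , b , _) → node (encodeℕ b) (env i))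
                (λ (i , b , _) → encodeMaybe (enc i) (attempt i b)) →
              Runs s (searchP p) (λ i → node (encodeList id (l i)) (env i))
                (λ i → enc i (Search.search (attempt i) (goal i) (goal-just i) (l i) (goal< i)))
runs-search {I} {s} {R = R} enc env attempt goal goal-just l l≤ goal< rp =
  runs-pair runs-hd (runs-pair runs-nil (runs-pair runs-nil runs-tl))
  ⨾ᴿ runs-foldl (λ _ → id) encodeState (λ i → S.searchStep i) l (λ i → S.searching 0 z≤n) l≤
       (runs-if (runs-tl ⨾ᴿ runs-hd)
         (runs-≡ runs-tl λ { ((_ , S.found _ _ , _) , _) → refl ; ((_ , S.searching _ _ , _) , ()) })
         (runs-via {J = Σ I λ i → ∃ λ b → b ≤ goal i × Tree}
                   {x′ = λ (i , b , _ , w) → node w (node leaf (node (encodeℕ b) (env i)))}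
           (runs-≡
             (runs-pair (runs-tl ⨾ᴿ runs-tl ⨾ᴿ runs-via rp λ (i , b , b≤ , _) → (i , b , b≤) , refl)
               (runs-pair (runs-pair runs-nil (runs-tl ⨾ᴿ runs-tl ⨾ᴿ runs-hd)) (runs-tl ⨾ᴿ runs-tl ⨾ᴿ runs-tl)))
             λ (i , b , b≤ , w) → sym (encode-advance i b (attempt i b) (S.not-yet i b≤)))
           λ { ((i , S.searching b b≤ , a , w) , _) → (i , b , b≤ , node a w) , refl ; ((_ , S.found _ _ , _) , ()) }))
  ⨾ᴿ runs-≡ (runs-hd ⨾ᴿ runs-hd) λ i → cong (hdT ∘ hdT ∘ encodeState i)
       (proj₂ (proj₂ (S.search-finds i (l i) 0 z≤n (goal< i))))
  where
  module S (i : I) = Search (attempt i) (goal i) (goal-just i)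
  encodeState : ∀ i → S.SearchState i → Tree
  encodeState i (S.searching b _) = node leaf (node (encodeℕ b) (env i))
  encodeState i (S.found d r)     = node (encodeMaybe (enc i) (just r)) (node (encodeℕ d) (env i))
  encode-advance : ∀ i b r h → encodeState i (S.advance i b r h) ≡
                   node (encodeMaybe (enc i) r) (node (encodeℕ (suc b)) (env i))
  encode-advance i b (just _) h = refl
  encode-advance i b nothing  h = refl

module _ {I : Set} {s : I → Scale} (G : I → Graph) (G≤ : ∀ i → order (G i) ≤ size (s i)) where

  rows≤ : ∀ i → length (leaf ∷ rows (G i)) ≤ 2 + size (s i)
  rows≤ i = s≤s (m≤n⇒m≤1+n (≤-trans (≤-reflexive (length-tabulate (row (G i)))) (G≤ i)))

  -- The additional `leaf` gives `order G + 1` rounds, one for each value from 0 to `order G`, in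
  -- both loops.
  runs-rows : ∀ {p x} → Runs s p x (λ i → node leaf (encodeGraph (G i))) →
              Runs s p x (λ i → encodeList id (leaf ∷ rows (G i)))
  runs-rows r = runs-≡ r λ i → cong (node leaf) (encodeGraph-rows (G i))

  runs-order : Runs s lengthP (λ i → encodeGraph (G i)) (λ i → encodeℕ (order (G i)))
  runs-order = runs-via (runs-length (λ _ → id) (λ i → rows (G i)) (λ i → m≤n⇒m≤1+n (≤-pred (rows≤ i))))
    λ i → i , cong₂ (λ M n → s i , M , encodeℕ n) (sym (encodeGraph-rows (G i))) (length-tabulate (row (G i)))

-- Correctness and running time of the combined algorithm

module Essential-Deletion {C : GraphClass} (hereditary : Hereditary C)
              {f : ℕ → ℕ} (f-mono : f Preserves _≤_ ⟶ _≤_)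
              {A : Program} (solvesA : SolvesDeletionParameterized C A f)
              {c : ℝ} {B : Program} (solvesB : SolvesDetectionPolyTime C B c) where

  open Deletion {C} hereditary {f} {A} solvesA

  detected : ∀ G → ℕ → Subset (order G)
  detected G k = proj₁ (proj₂ solvesB G k)

  detected⊆minimum : ∀ G k o → (Opt_≔_ C G o) → o ≤ k → ∃ λ T → IsMinimumModulator C G T × detected G k ⊆ T
  detected⊆minimum G k = proj₁ (proj₂ (proj₂ (proj₂ (proj₂ (proj₂ solvesB G k)))))

  essential∈detected : ∀ G k → (Opt_≔_ C G k) → ∀ v → Essential C c G v → v ∈ detected G k
  essential∈detected G k = proj₂ (proj₂ (proj₂ (proj₂ (proj₂ (proj₂ solvesB G k)))))

  -- As `k` is within the size, the bound in `order + k` becomes one in the size alone; squaring the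
  -- base absorbs the doubling.
  runs-B : {I : Set} {s : I → Scale} (G : I → Graph) (k : I → ℕ) →
           (∀ i → order (G i) ≤ size (s i)) → (∀ i → k i ≤ size (s i)) →
           Runs s B (λ i → encodeInstance (G i) (k i)) (λ i → encodeSubset (detected (G i) (k i)))
  runs-B {s = s} G k G≤ k≤ = runs-rescale {s = λ i → scale (order (G i) + k i) 1 ≤-refl} 2 0
    doubled (λ i → 1≤^^0 (s i))
    (runs (proj₁ solvesB) λ i → let (_ , t , B⇓ , t≤ , _) = proj₂ solvesB (G i) (k i)
                               in t , B⇓ , affordable (≤-trans t≤ (≤-reflexive (sym (*-identityˡ _)))))
    where
    doubled : ∀ i → 2 + (order (G i) + k i) ≤ (2 + size (s i)) ^ 2
    doubled i = begin
      2 + order (G i) + k i       ≤⟨ +-mono-≤ (+-monoʳ-≤ 2 (G≤ i)) (m≤n⇒m≤o+n 2 (k≤ i)) ⟩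
      N + N                       ≡⟨ cong (N +_) (+-identityʳ N) ⟨
      2 * N                       ≤⟨ *-mono-≤ (m≤m+n 2 (size (s i))) (≤-reflexive (sym (*-identityʳ N))) ⟩
      N ^ 2                       ∎
      where
      open ≤-Reasoning
      N = 2 + size (s i)

  module _ (G : Graph) (modulator : ∃ (IsModulator C G)) where

    -- A minimum cannot be found by enumeration when `C` is undecidable, but `A` with the budget
    -- `order G` provides one. This call serves the proof and is never executed.
    minimum : Result C G
    minimum = let (S , mod) = modulator ; (R , min , _) = output-minimum G (order G) S mod (∣p∣≤n S) in R , min

    optimum : ℕ
    optimum = ∣ proj₁ minimum ∣

    optimal : (Opt_≔_ C G optimum)
    optimal = proj₁ minimum , proj₂ minimum , refl

    optimum-unique : ∀ {o} → (Opt_≔_ C G o) → o ≡ optimum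
    optimum-unique (S , (mod , min) , refl) =
      ≤-antisym (min _ (proj₁ (proj₂ minimum))) (proj₂ (proj₂ minimum) S mod)

    []∈C : C (induced G [])
    []∈C = hereditary {G ∖ proj₁ modulator} (induced-[]-⊑ G (G ∖ proj₁ modulator)) (proj₂ modulator)

    candidate : ℕ → ℕ → Subset (order G)
    candidate b k = extend (detected G k) (output (G ∖ detected G k) b)

    Accepted : ℕ → ℕ → Set
    Accepted b k = ∣ candidate b k ∣ ≤ k × ∣ candidate b k ∣ ≤ ∣ detected G k ∣ + b
                 × violations G (remaining (candidate b k)) ≡ 0

    accepted? : ∀ b k → Dec (Accepted b k)
    accepted? b k = ∣ candidate b k ∣ ≤? k ×-dec ∣ candidate b k ∣ ≤? ∣ detected G k ∣ + b
                    ×-dec violations G (remaining (candidate b k)) ≟ 0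

    -- Serves soundness and completeness alike: either side only has to show that a minimum
    -- modulator containing the detected set fits the budget.
    candidate-optimal : ∀ b k T → IsMinimumModulator C G T → detected G k ⊆ T → ∣ T ∣ ≤ ∣ detected G k ∣ + b →
                        IsModulator C G (candidate b k) × ∣ candidate b k ∣ ≤ ∣ T ∣
    candidate-optimal b k T (mod , min) S⊆T T≤ =
        subst (λ r → IsModulator C G (extend S r)) (sym r≡)
          (hereditary {(G ∖ S) ∖ R} {G ∖ extend S (encodeSubset R)} (∖-extend-⊑ G S R) R-mod)
      , (begin
          ∣ candidate b k ∣              ≡⟨ cong (λ r → ∣ extend S r ∣) r≡ ⟩
          ∣ extend S (encodeSubset R) ∣  ≡⟨ ∣extend∣ S R ⟩
          ∣ S ∣ + ∣ R ∣                  ≤⟨ +-monoʳ-≤ ∣ S ∣ (R-min (restrict S T) rest-mod) ⟩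
          ∣ S ∣ + ∣ restrict S T ∣       ≡⟨ ∣restrict∣ S T S⊆T ⟨
          ∣ T ∣                          ∎)
      where
      open ≤-Reasoning
      S = detected G k
      rest-mod : IsModulator C (G ∖ S) (restrict S T)
      rest-mod = hereditary {G ∖ T} {(G ∖ S) ∖ restrict S T} (∖-restrict-⊑ G S T) mod
      solved = output-minimum (G ∖ S) b (restrict S T) rest-mod
        (+-cancelˡ-≤ ∣ S ∣ _ _ (≤-trans (≤-reflexive (sym (∣restrict∣ S T S⊆T))) T≤))
      R     = proj₁ solved
      R-mod = proj₁ (proj₁ (proj₂ solved))
      R-min = proj₂ (proj₁ (proj₂ solved))
      r≡    = proj₂ (proj₂ solved)

    accepted⇒minimum : ∀ b k → Accepted b k → IsMinimumModulator C G (candidate b k)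
    accepted⇒minimum b k (X≤k , X≤S+b , no-violations) = X-mod , λ U U-mod → ≤-trans X≤T (proj₂ T-min U U-mod)
      where
      X-mod = violations≡0⇒∈C G []∈C (remaining (candidate b k)) no-violations
      detection = detected⊆minimum G k optimum optimal (≤-trans (proj₂ (proj₂ minimum) (candidate b k) X-mod) X≤k)
      T     = proj₁ detection
      T-min = proj₁ (proj₂ detection)
      X≤T   = proj₂ (candidate-optimal b k T T-min (proj₂ (proj₂ detection))
                (≤-trans (proj₂ T-min (candidate b k) X-mod) X≤S+b))

    -- Measured by the detected set rather than the essential one, so that the search has a definite
    -- goal even though no essential set is given.
    excess : ℕ
    excess = optimum ∸ ∣ detected G optimum ∣

    excess≤order : excess ≤ order G
    excess≤order = ≤-trans (m∸n≤m optimum ∣ detected G optimum ∣) (∣p∣≤n (proj₁ minimum))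

    excess-accepted : Accepted excess optimum
    excess-accepted =
        ≤-trans X≤T (≤-reflexive T≡)
      , ≤-trans X≤T T≤
      , ∈C⇒violations≡0 G (remaining (candidate excess optimum)) X-mod
      where
      detection = detected⊆minimum G optimum optimum optimal ≤-refl
      T     = proj₁ detection
      T≡    = optimum-unique (T , proj₁ (proj₂ detection) , refl)
      T≤    = ≤-trans (≤-reflexive T≡) (m≤n+m∸n optimum ∣ detected G optimum ∣)
      found = candidate-optimal excess optimum T (proj₁ (proj₂ detection)) (proj₂ (proj₂ detection)) T≤
      X-mod = proj₁ found
      X≤T   = proj₂ found

    excess≤ : ∀ o E → (Opt_≔_ C G o) → IsEssentialSet C c G E → excess ≤ o ∸ ∣ E ∣
    excess≤ o E o-opt E-essential rewrite optimum-unique o-opt =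
      ∸-monoʳ-≤ optimum (p⊆q⇒∣p∣≤∣q∣ {p = E} {q = detected G optimum} λ {v} v∈E →
        essential∈detected G optimum optimal v (Equivalence.to (E-essential v) v∈E))

    attempt : ℕ → ℕ → Maybe (Result C G)
    attempt b k = toMaybe (accepted? b k) (λ acc → candidate b k , accepted⇒minimum b k acc)

    attempts : ℕ → Maybe (Result C G)
    attempts b = Sweep.sweep (order G) (attempt b) (leaf ∷ rows G)

    attempts-excess : Is-just (attempts excess)
    attempts-excess = Sweep.sweep-finds (order G) (attempt excess) (leaf ∷ rows G) optimum
      (toMaybe-just (accepted? excess optimum) _ excess-accepted) (∣p∣≤n (proj₁ minimum))
      (s≤s (≤-reflexive (sym (length-tabulate (row G)))))

    excess<rows : excess < length (leaf ∷ rows G)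
    excess<rows = s≤s (≤-trans excess≤order (≤-reflexive (sym (length-tabulate (row G)))))

    solution : Result C G
    solution = Search.search attempts excess attempts-excess (leaf ∷ rows G) excess<rows

  -- Intermediate results are stacked in front of the input: the store grows from `(k, (b, G))` to
  -- `(S, (k, (b, G)))` and then `(X, (S, (k, (b, G))))`, with `S` the detected set and `X` the
  -- candidate.
  attemptP : Program
  attemptP =
    ⟨ ⟨ tl ⨾ tl , hd ⟩ ⨾ B , skip ⟩
    ⨾ ⟨ ⟨ hd , ⟨ ⟨ tl ⨾ tl ⨾ tl , hd ⟩ ⨾ subgraphP , tl ⨾ tl ⨾ hd ⟩ ⨾ A ⟩ ⨾ extendP , skip ⟩
    -- The inner `nil` adds 1 to `k`, so that a nonzero difference means at most `k` and not less
    -- than `k`.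
    ⨾ if ⟨ hd , ⟨ nil , tl ⨾ tl ⨾ hd ⟩ ⟩ ⨾ subWeightP
      then (if ⟨ hd , ⟨ nil , ⟨ tl ⨾ hd , tl ⨾ tl ⨾ tl ⨾ hd ⟩ ⨾ addWeightP ⟩ ⟩ ⨾ subWeightP
            then (if ⟨ tl ⨾ tl ⨾ tl ⨾ tl , hd ⟩ ⨾ subgraphP ⨾ testP then nil else ⟨ hd , nil ⟩)
            else nil)
      else nil

  attemptsP : Program
  attemptsP = ⟨ ⟨ nil , tl ⟩ , ⟨ tl ⨾ lengthP , skip ⟩ ⟩ ⨾ sweepP attemptP

  module _ {I : Set} {s : I → Scale} (G : I → Graph) (mod : ∀ i → ∃ (IsModulator C (G i)))
           (G≤ : ∀ i → order (G i) ≤ size (s i)) where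

    runs-attempt : (b k : I → ℕ) → (∀ i → k i ≤ size (s i)) → (∀ i → f (b i) ≤ s i ^^ 0) →
                   Runs s attemptP (λ i → node (encodeℕ (k i)) (node (encodeℕ (b i)) (encodeGraph (G i))))
                     (λ i → encodeMaybe (encodeResult C (G i)) (attempt (G i) (mod i) (b i) (k i)))
    runs-attempt b k k≤ f≤ =
      runs-pair (runs-pair (runs-tl ⨾ᴿ runs-tl) runs-hd ⨾ᴿ runs-B G k G≤ k≤) runs-skip
      ⨾ᴿ runs-pair
           (runs-pair runs-hd
             (runs-pair (runs-pair (runs-tl ⨾ᴿ runs-tl ⨾ᴿ runs-tl) runs-hd ⨾ᴿ runs-subgraph G S G≤)
               (runs-tl ⨾ᴿ runs-tl ⨾ᴿ runs-hd)
              ⨾ᴿ runs-A (λ i → G i ∖ S i) b 0 (λ i → ≤-trans (length-remaining (S i)) (G≤ i)) f≤)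
            ⨾ᴿ runs-extend S (λ i → output (G i ∖ S i) (b i)) (λ i → m≤n⇒m≤o+n 2 (G≤ i)))
           runs-skip
      ⨾ᴿ runs-≡
           (runs-if-else
             (runs-pair runs-hd (runs-pair runs-nil (runs-tl ⨾ᴿ runs-tl ⨾ᴿ runs-hd))
              ⨾ᴿ runs-subWeight (toList ∘ X) (suc ∘ k) X≤)
             (runs-if-else
               (runs-pair runs-hd (runs-pair runs-nil (runs-pair (runs-tl ⨾ᴿ runs-hd)
                   (runs-tl ⨾ᴿ runs-tl ⨾ᴿ runs-tl ⨾ᴿ runs-hd)
                 ⨾ᴿ runs-addWeight (toList ∘ S) b S≤))
                ⨾ᴿ runs-subWeight (toList ∘ X) (λ i → suc (weight (toList (S i)) + b i)) X≤)
               (runs-if-else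
                 (runs-pair (runs-tl ⨾ᴿ runs-tl ⨾ᴿ runs-tl ⨾ᴿ runs-tl) runs-hd ⨾ᴿ runs-subgraph G X G≤
                  ⨾ᴿ runs-test G (λ i → remaining (X i)) (λ i → ≤-trans (length-remaining (X i)) (G≤ i)))
                 runs-nil
                 (runs-pair runs-hd runs-nil))
               runs-nil)
             runs-nil)
           encoded
      where
      S X : ∀ i → Subset (order (G i))
      S i = detected (G i) (k i)
      X i = extend (S i) (output (G i ∖ S i) (b i))
      short : ∀ i (T : Subset (order (G i))) → length (toList T) ≤ 2 + size (s i)
      short i T = ≤-trans (≤-reflexive (length-toList T)) (m≤n⇒m≤o+n 2 (G≤ i))
      X≤ : ∀ i → length (toList (X i)) ≤ 2 + size (s i)
      X≤ i = short i (X i)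
      S≤ : ∀ i → length (toList (S i)) ≤ 2 + size (s i)
      S≤ i = short i (S i)
      encoded : ∀ i → (Bool.if isNode (encodeℕ (suc (k i) ∸ weight (toList (X i))))
                       then Bool.if isNode (encodeℕ (suc (weight (toList (S i)) + b i) ∸ weight (toList (X i))))
                            then Bool.if isNode (encodeℕ (violations (G i) (remaining (X i)))) then leaf
                                 else node (encodeSubset (X i)) leaf
                            else leaf
                       else leaf)
                    ≡ encodeMaybe (encodeResult C (G i)) (attempt (G i) (mod i) (b i) (k i))
      encoded i = trans
        (nested-if (∣ X i ∣ ≤ᵇ k i) (∣ X i ∣ ≤ᵇ ∣ S i ∣ + b i) (violations (G i) (remaining (X i)) ≡ᵇ 0)
          (trans (isNode-monus (k i) (weight (toList (X i)))) (cong (_≤ᵇ k i) (sym (∣∣≡weight (X i)))))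
          (trans (isNode-monus (weight (toList (S i)) + b i) (weight (toList (X i))))
            (cong₂ (λ x y → x ≤ᵇ y + b i) (sym (∣∣≡weight (X i))) (sym (∣∣≡weight (S i)))))
          (isNode-encodeℕ (violations (G i) (remaining (X i)))))
        (sym (encodeMaybe-toMaybe (encodeResult C (G i)) (accepted? (G i) (mod i) (b i) (k i)) _
          (encodeSubset (X i)) (λ _ → refl)))

  module _ {I : Set} {s : I → Scale} (G : I → Graph) (mod : ∀ i → ∃ (IsModulator C (G i)))
           (G≤ : ∀ i → order (G i) ≤ size (s i)) where

    runs-attempts : (b : I → ℕ) → (∀ i → f (b i) ≤ s i ^^ 0) →
                    Runs s attemptsP (λ i → node (encodeℕ (b i)) (encodeGraph (G i)))
                      (λ i → encodeMaybe (encodeResult C (G i)) (attempts (G i) (mod i) (b i)))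
    runs-attempts b f≤ =
      runs-pair (runs-rows G G≤ (runs-pair runs-nil runs-tl)) (runs-pair (runs-tl ⨾ᴿ runs-order G G≤) runs-skip)
      ⨾ᴿ runs-sweep (λ i → encodeResult C (G i)) (λ i → node (encodeℕ (b i)) (encodeGraph (G i)))
           (λ i → order (G i)) (λ i → attempt (G i) (mod i) (b i)) (λ i → leaf ∷ rows (G i)) (rows≤ {s = s} G G≤)
           (runs-attempt (G ∘ proj₁) (mod ∘ proj₁) (G≤ ∘ proj₁) (b ∘ proj₁) (proj₁ ∘ proj₂)
             (λ (i , _ , k≤) → ≤-trans k≤ (G≤ i)) (f≤ ∘ proj₁))

  solveP : Program
  solveP = ⟨ ⟨ nil , skip ⟩ , skip ⟩ ⨾ searchP attemptsP

  Solvable : Set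
  Solvable = ∃ λ G → ∃ (IsModulator C G)

  -- The factor may depend on `excess`, which the program never computes, because a scale enters
  -- time bounds only.
  solveScale : Solvable → Scale
  solveScale (G , mod) = scale (order G) (f (excess G mod)) (f-pos (excess G mod))

  runs-solve : Runs solveScale solveP (λ (G , _) → encodeGraph G) (λ (G , mod) → encodeResult C G (solution G mod))
  runs-solve =
    runs-pair (runs-rows proj₁ (λ _ → ≤-refl) (runs-pair runs-nil runs-skip)) runs-skip
    ⨾ᴿ runs-search (λ (G , _) → encodeResult C G) (λ (G , _) → encodeGraph G) (λ (G , mod) → attempts G mod)
         (λ (G , mod) → excess G mod) (λ (G , mod) → attempts-excess G mod) (λ (G , _) → leaf ∷ rows G)
         (rows≤ {s = solveScale} proj₁ (λ _ → ≤-refl)) (λ (G , mod) → excess<rows G mod)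
         (runs-attempts (proj₁ ∘ proj₁) (proj₂ ∘ proj₁) (λ _ → ≤-refl) (proj₁ ∘ proj₂)
           -- The search state supplies `b ≤ excess`, and monotonicity of `f` makes the factor alone
           -- sufficient, with exponent 0.
           λ (_ , _ , b≤) → affordable (≤-trans (f-mono b≤) (≤-reflexive (sym (*-identityʳ _)))))

  -- Taking the bound as an argument keeps the numeral exponent unevaluated.
  solves : Runs solveScale solveP (λ (G , _) → encodeGraph G) (λ (G , mod) → encodeResult C G (solution G mod)) →
           SolvesDeletionBeyondEssential C solveP c f
  solves (runs d run) = d , λ G mod →
    let (t , P⇓ , affordable t≤) = run (G , mod)
        (S , S-min)              = solution G mod
    in S , t , P⇓ , S-min , λ o E o-opt E-essential →
      ≤-trans t≤ (*-monoˡ-≤ ((2 + order G) ^ d) (f-mono (excess≤ G mod o E o-opt E-essential)))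

theorem11 : (C : GraphClass) → Hereditary C →
    (c : ℝ) → 1≤ c →
    (f : ℕ → ℕ) → f Preserves _≤_ ⟶ _≤_ →
    (A : Program) → SolvesDeletionParameterized C A f →
    (B : Program) → SolvesDetectionPolyTime C B c →
    ∃ λ P → SolvesDeletionBeyondEssential C P c f
theorem11 C hereditary c 1≤c f f-mono A solvesA B solvesB = solveP , solves runs-solve
  where open Essential-Deletion {C} hereditary {f} f-mono {A} solvesA {c} {B} solvesB
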